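{- The parameterized problem \textsc{Long Path}[vc] admits a polynomial boundaried kernelization whose output graph has $\mathcal{O}((|B|+k)^2)$ vertices, where $B$ is the boundary of the input boundaried graph $G_B$ and $k$ is the size of the given vertex cover of $G$.
   Context: A boundaried graph $G_B$ is a finite simple graph $G$ together with a set $B\subseteq V(G)$ (the boundary). For boundaried graphs $G_B$ and $H_C$ with $V(G)\cap V(H)\subseteq B\cap C$, the gluing $G_B\oplus H_C$ is the simple graph obtained from the disjoint union of $G$ and $H$ by identifying each vertex of $B\cap C$ in $G$ with the identically named vertex in $H$ (an edge present in both is kept once). A pure graph problem is either a decision problem given by an isomorphism-closed class $\Pi$ of graphs, or an isomorphism-invariant optimization (minimization or maximization) problem on graphs; for the latter, $\mathrm{OPT}_\Pi(G)$ denotes the optimum solution value ($+\infty$, resp. $-\infty$, if a minimization, resp. maximization, problem has no feasible solution). Two $B$-boundaried graphs $G_B,G'_B$ are gluing equivalent w.r.t. $\Pi$ and $B$, written $G_B\equiv_{\Pi,B}G'_B$, if: for a decision problem, for every boundaried graph $H_B$ we have $G_B\oplus H_B\in\Pi\iff G'_B\oplus H_B\in\Pi$; for an optimization problem, there is a constant $\Delta\in\mathbb{Z}$ (the offset) such that $\mathrm{OPT}_\Pi(G_B\oplus H_B)=\mathrm{OPT}_\Pi(G'_B\oplus H_B)+\Delta$ for every boundaried graph $H_B$. For a pure graph minimization problem $\rho$, a $\rho$-solution of $G$ is a feasible solution $s$ of $\rho$ on $G$, with value $\rho(G,s)$. For computable $f$, a boundaried kernelization of size $f$ for $\Pi[\rho]$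 is a polynomial-time algorithm that, given a boundaried graph $G_B$ and a $\rho$-solution $s$ of $G$, outputs a boundaried graph $G'_B$ with $G_B\equiv_{\Pi,B}G'_B$ and a $\rho$-solution $s'$ of $G'$ such that $|G'|,|s'|,\rho(G',s')\le f(|B|+\rho(G,s))$ (here $|\cdot|$ is encoding size), and, if $\Pi$ is an optimization problem, additionally an integer $\Delta$ with $\mathrm{OPT}_\Pi(G_B\oplus H_B)=\mathrm{OPT}_\Pi(G'_B\oplus H_B)+\Delta$ for all $H_B$. It is a polynomial boundaried kernelization if $f$ is bounded by a polynomial. \textsc{Long Path} is the maximization problem whose feasible solutions on $G$ are paths $(v_1,\dots,v_r)$ with distinct vertices, with value $r-1$. \textsc{Vertex Cover} (vc) is the minimization problem with feasible solutions $S\subseteq V(G)$ such that $G-S$ is edgeless, value $|S|$. \textsc{Long Path}[vc] is $\Pi[\rho]$ with $\Pi=$ \textsc{Long Path}, $\rho=$ \textsc{Vertex Cover}. -}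

module Defs where

open import Data.Bool using (Bool; true; false)
import Data.Bool.Properties as Bool
open import Data.Fin using (Fin; zero)
open import Data.Integer as ℤ using (ℤ; +_; -[1+_])
open import Data.List using (List; []; _∷_; _++_; length; map; filter; foldr; replicate)
open import Data.List.Properties using (≡-dec; length-map)
open import Data.List.Membership.Propositional using (_∈_; _∉_)
open import Data.List.Membership.Propositional.Properties
  using (∈-++⁺ˡ; ∈-++⁺ʳ; ∈-filter⁺; ∈-filter⁻; ∈-map⁺)
import Data.List.Membership.DecPropositional as DecMembership
open import Data.List.Relation.Unary.All as All using (All; []; _∷_)
import Data.List.Relation.Unary.All.Properties as Allₚ
open import Data.List.Relation.Unary.AllPairs as AllPairs using (AllPairs; []; _∷_)
import Data.List.Relation.Unary.AllPairs.Properties as AllPairsₚ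
open import Data.List.Relation.Unary.Linked as Linked using (Linked; []; [-]; _∷_)
import Data.List.Relation.Unary.Linked.Properties as Linkedₚ
open import Data.List.Relation.Unary.Unique.Propositional using (Unique)
import Data.List.Relation.Unary.Unique.Propositional.Properties as Uniqueₚ
open import Data.Nat using (ℕ; suc; _+_; _*_; _∸_; _^_; _≤_)
import Data.Nat.Binary as Bin
open import Data.Nat.Logarithm using (⌈log₂_⌉)
open import Data.Product using (∃-syntax; _×_; _,_; proj₁; proj₂)
open import Data.Product.Properties using () renaming (≡-dec to ×-≡-dec)
open import Data.Sum using (_⊎_; inj₁; inj₂)
open import Data.Vec as Vec using (Vec; []; _∷_)
open import Function.Bundles using (_⇔_)
open import Relation.Binary.Definitions using (DecidableEquality)
open import Relation.Binary.PropositionalEquality using (_≡_; _≢_; refl; sym; trans; cong; subst)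
open import Relation.Nullary using (¬_; Dec; yes; no)
open import Relation.Nullary.Construct.Add.Extrema using (_±; ⊥±; ⊤±; [_])
open import Relation.Nullary.Decidable using (¬?; _⊎-dec_; _×-dec_)

------------------------------------------------------------------------
-- Finite simple graphs and boundaried graphs

-- Vertices are named by finite binary words, so that arbitrary finite
-- vertex sets can be handed to an algorithm.
Name : Set
Name = List Bool

_≟ᴺ_ : DecidableEquality Name
_≟ᴺ_ = ≡-dec Bool._≟_

module NameMembership = DecMembership _≟ᴺ_
module EdgeMembership = DecMembership (×-≡-dec _≟ᴺ_ _≟ᴺ_)
open NameMembership using (_∈?_)

-- (u , v) and (v , u) present the same undirected edge.
SameEdge : Name × Name → Name × Name → Set
SameEdge (a , b) (c , d) = (a ≡ c × b ≡ d) ⊎ (a ≡ d × b ≡ c)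

record Graph : Set where
  field
    V        : List Name
    E        : List (Name × Name)
    V-unique : Unique V
    E-unique : AllPairs (λ e e′ → ¬ SameEdge e e′) E
    E-simple : All (λ e → proj₁ e ∈ V × proj₂ e ∈ V × proj₁ e ≢ proj₂ e) E

open Graph public

Adj : Graph → Name → Name → Set
Adj G u v = ((u , v) ∈ E G) ⊎ ((v , u) ∈ E G)

adj? : (G : Graph) (u v : Name) → Dec (Adj G u v)
adj? G u v = (u , v) EdgeMembership.∈? E G ⊎-dec (v , u) EdgeMembership.∈? E G

infixl 6 _−_

_−_ : Graph → List Name → Graph
G − S = record
  { V        = filter keepV? (V G)
  ; E        = filter keepE? (E G)
  ; V-unique = Uniqueₚ.filter⁺ keepV? (V-unique G)
  ; E-unique = AllPairsₚ.filter⁺ keepE? (E-unique G)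
  ; E-simple = All.tabulate λ e∈ →
      let e∈E , u∉S , v∉S = ∈-filter⁻ keepE? e∈
          u∈V , v∈V , u≢v = All.lookup (E-simple G) e∈E
      in ∈-filter⁺ keepV? u∈V u∉S , ∈-filter⁺ keepV? v∈V v∉S , u≢v
  }
  where
  keepV? : (v : Name) → Dec (v ∉ S)
  keepV? v = ¬? (v ∈? S)
  keepE? : (e : Name × Name) → Dec (proj₁ e ∉ S × proj₂ e ∉ S)
  keepE? e = keepV? (proj₁ e) ×-dec keepV? (proj₂ e)

Edgeless : Graph → Set
Edgeless G = ∀ u v → ¬ Adj G u v

record _≅_ (G H : Graph) : Set where
  field
    to       : Name → Name
    from     : Name → Name
    to-V     : ∀ {v} → v ∈ V G → to v ∈ V H
    from-V   : ∀ {v} → v ∈ V H → from v ∈ V G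
    from-to  : ∀ {v} → v ∈ V G → from (to v) ≡ v
    to-from  : ∀ {v} → v ∈ V H → to (from v) ≡ v
    to-Adj   : ∀ {u v} → Adj G u v → Adj H (to u) (to v)
    from-Adj : ∀ {u v} → Adj H u v → Adj G (from u) (from v)

record BoundariedGraph (B : List Name) : Set where
  field
    graph    : Graph
    B-unique : Unique B
    B⊆V      : All (_∈ V graph) B

open BoundariedGraph public

Gluable : ∀ {B C} → BoundariedGraph B → BoundariedGraph C → Set
Gluable {B} {C} G H =
  ∀ {v} → v ∈ V (graph G) → v ∈ V (graph H) → v ∈ B × v ∈ C

infixl 6 _⊕_

-- The union of the two graphs. It is the gluing of G and H whenever they
-- are Gluable, since then exactly the vertices of B ∩ C are shared.
_⊕_ : ∀ {B C} → BoundariedGraph B → BoundariedGraph C → Graph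
G′ ⊕ H′ = record
  { V        = V G ++ filter newV? (V H)
  ; E        = E G ++ filter newE? (E H)
  ; V-unique = Uniqueₚ.++⁺ (V-unique G) (Uniqueₚ.filter⁺ newV? (V-unique H))
                 λ (v∈G , v∈H) → proj₂ (∈-filter⁻ newV? {xs = V H} v∈H) v∈G
  ; E-unique = AllPairsₚ.++⁺ (E-unique G) (AllPairsₚ.filter⁺ newE? (E-unique H))
                 (All.tabulate λ e∈G → All.tabulate λ e′∈H →
                   distinct e∈G (proj₂ (∈-filter⁻ newE? {xs = E H} e′∈H)))
  ; E-simple = Allₚ.++⁺
      (All.map (λ (u∈ , v∈ , u≢v) → ∈-++⁺ˡ u∈ , ∈-++⁺ˡ v∈ , u≢v) (E-simple G))
      (Allₚ.filter⁺ newE?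
        (All.map (λ (u∈ , v∈ , u≢v) → inH u∈ , inH v∈ , u≢v) (E-simple H)))
  }
  where
  G H : Graph
  G = graph G′
  H = graph H′
  newV? : (v : Name) → Dec (v ∉ V G)
  newV? v = ¬? (v ∈? V G)
  newE? : (e : Name × Name) → Dec (¬ Adj G (proj₁ e) (proj₂ e))
  newE? e = ¬? (adj? G (proj₁ e) (proj₂ e))
  distinct : ∀ {e e′} → e ∈ E G → ¬ Adj G (proj₁ e′) (proj₂ e′) → ¬ SameEdge e e′
  distinct e∈ ¬adj (inj₁ (refl , refl)) = ¬adj (inj₁ e∈)
  distinct e∈ ¬adj (inj₂ (refl , refl)) = ¬adj (inj₂ e∈)
  inH : ∀ {v} → v ∈ V H → v ∈ V G ++ filter newV? (V H)
  inH {v} v∈ with v ∈? V G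
  ... | yes v∈G = ∈-++⁺ˡ v∈G
  ... | no  v∉G = ∈-++⁺ʳ (V G) (∈-filter⁺ newV? v∈ v∉G)

------------------------------------------------------------------------
-- Polynomial-time computation

-- First-order recursive programs on binary trees: the language F of
-- N. D. Jones, "Computability and Complexity from a Programming
-- Perspective", extended by a let construct. A program is a finite
-- table of mutually recursive one-argument functions; function zero is
-- the main one. nil counts as false, every other tree as true.

infixr 5 _∙_

data Data : Set where
  nil : Data
  _∙_ : Data → Data → Data

∥_∥ : Data → ℕ
∥ nil ∥   = 1
∥ a ∙ b ∥ = 1 + ∥ a ∥ + ∥ b ∥

infix 4 if_then_else_

-- m function symbols, n variables in scope.
data Exp (m n : ℕ) : Set where
  var           : Fin n → Exp m n
  nil           : Exp m n
  cons          : Exp m n → Exp m n → Exp m n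
  hd tl         : Exp m n → Exp m n
  if_then_else_ : Exp m n → Exp m n → Exp m n → Exp m n
  let′          : Exp m n → Exp m (suc n) → Exp m n
  call          : Fin m → Exp m n → Exp m n

head tail : Data → Data
head nil     = nil
head (a ∙ b) = a
tail nil     = nil
tail (a ∙ b) = b

infix 4 _,_⊢_⇓_⟨_⟩

-- F , ρ ⊢ e ⇓ v ⟨ t ⟩ : with function table F and environment ρ, the
-- expression e evaluates to v in t steps. One step adds at most one node
-- to the shared (dag) representation of all trees in memory, which is why
-- counting steps agrees with Turing machine time up to a polynomial.
data _,_⊢_⇓_⟨_⟩ {m : ℕ} (F : Vec (Exp m 1) m) {n : ℕ} (ρ : Vec Data n) :
                 Exp m n → Data → ℕ → Set where
  ⇓var : ∀ {i} → F , ρ ⊢ var i ⇓ Vec.lookup ρ i ⟨ 1 ⟩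
  ⇓nil : F , ρ ⊢ nil ⇓ nil ⟨ 1 ⟩
  ⇓cons : ∀ {e₁ e₂ v₁ v₂ t₁ t₂} →
          F , ρ ⊢ e₁ ⇓ v₁ ⟨ t₁ ⟩ → F , ρ ⊢ e₂ ⇓ v₂ ⟨ t₂ ⟩ →
          F , ρ ⊢ cons e₁ e₂ ⇓ v₁ ∙ v₂ ⟨ 1 + t₁ + t₂ ⟩
  ⇓hd : ∀ {e v t} → F , ρ ⊢ e ⇓ v ⟨ t ⟩ → F , ρ ⊢ hd e ⇓ head v ⟨ 1 + t ⟩
  ⇓tl : ∀ {e v t} → F , ρ ⊢ e ⇓ v ⟨ t ⟩ → F , ρ ⊢ tl e ⇓ tail v ⟨ 1 + t ⟩
  ⇓true : ∀ {e₀ e₁ e₂ a b v t₀ t} →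
          F , ρ ⊢ e₀ ⇓ a ∙ b ⟨ t₀ ⟩ → F , ρ ⊢ e₁ ⇓ v ⟨ t ⟩ →
          F , ρ ⊢ if e₀ then e₁ else e₂ ⇓ v ⟨ 1 + t₀ + t ⟩
  ⇓false : ∀ {e₀ e₁ e₂ v t₀ t} →
           F , ρ ⊢ e₀ ⇓ nil ⟨ t₀ ⟩ → F , ρ ⊢ e₂ ⇓ v ⟨ t ⟩ →
           F , ρ ⊢ if e₀ then e₁ else e₂ ⇓ v ⟨ 1 + t₀ + t ⟩
  ⇓let : ∀ {e₁ e₂ u v t₁ t₂} →
         F , ρ ⊢ e₁ ⇓ u ⟨ t₁ ⟩ → F , (u ∷ ρ) ⊢ e₂ ⇓ v ⟨ t₂ ⟩ →
         F , ρ ⊢ let′ e₁ e₂ ⇓ v ⟨ 1 + t₁ + t₂ ⟩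
  ⇓call : ∀ {f e u v t₁ t₂} →
          F , ρ ⊢ e ⇓ u ⟨ t₁ ⟩ → F , (u ∷ []) ⊢ Vec.lookup F f ⇓ v ⟨ t₂ ⟩ →
          F , ρ ⊢ call f e ⇓ v ⟨ 1 + t₁ + t₂ ⟩

record Program : Set where
  field
    {#functions} : ℕ
    functions    : Vec (Exp (suc #functions) 1) (suc #functions)

open Program public

Computes_⟨_⟩_within_ : Program → Data → Data → ℕ → Set
Computes P ⟨ x ⟩ y within T =
  ∃[ t ] functions P , (x ∷ []) ⊢ Vec.lookup (functions P) zero ⇓ y ⟨ t ⟩ × t ≤ T

PolynomiallyBounded : (ℕ → ℕ) → Set
PolynomiallyBounded f = ∃[ c ] ∃[ d ] ∀ n → f n ≤ c * n ^ d + c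

------------------------------------------------------------------------
-- Encodings and encoding sizes

encodeBool : Bool → Data
encodeBool false = nil
encodeBool true  = nil ∙ nil

encodeList : {A : Set} → (A → Data) → List A → Data
encodeList encode = foldr (λ x d → encode x ∙ d) nil

encodeName : Name → Data
encodeName = encodeList encodeBool

-- Bijective base 2, least significant digit first.
encodeℕᵇ : Bin.ℕᵇ → Data
encodeℕᵇ Bin.zero     = nil
encodeℕᵇ Bin.2[1+ n ] = encodeBool true ∙ encodeℕᵇ n
encodeℕᵇ Bin.1+[2 n ] = encodeBool false ∙ encodeℕᵇ n

encodeℤ : ℤ → Data
encodeℤ (+ n)    = encodeBool false ∙ encodeℕᵇ (Bin.fromℕ n)
encodeℤ -[1+ n ] = encodeBool true ∙ encodeℕᵇ (Bin.fromℕ n)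

-- Encodings are parametrised by the encoding ν of vertex names.
encodeGraph : (Name → Data) → Graph → Data
encodeGraph ν G =
  encodeList ν (V G) ∙ encodeList (λ (u , v) → ν u ∙ ν v) (E G)

encodeBoundariedGraph : ∀ {B} → (Name → Data) → BoundariedGraph B → Data
encodeBoundariedGraph {B} ν G = encodeGraph ν (graph G) ∙ encodeList ν B

-- The boundary names have to survive kernelization, and their lengths are
-- unrelated to |B| + k. The sizes |G| and |s| bounded by a kernelization
-- therefore are those of the encodings in which the n vertices have been
-- renamed to binary words of length ⌈log₂ n⌉; only the length of these
-- words affects the size. (Running times, in contrast, refer to the
-- encoding of the actual input, with its actual names.)
shortName : Graph → Name → Data
shortName G _ = encodeName (replicate ⌈log₂ length (V G) ⌉ false)

∣_∣ᴳ : Graph → ℕ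
∣ G ∣ᴳ = ∥ encodeGraph (shortName G) G ∥

------------------------------------------------------------------------
-- Pure graph optimization problems

data Goal : Set where
  minimize maximize : Goal

record OptProblem (goal : Goal) : Set₁ where
  field
    Solution  : Set
    encode    : (Name → Data) → Solution → Data
    Feasible  : Graph → Solution → Set
    value     : Graph → Solution → ℕ
    invariant : ∀ {G H} → G ≅ H → ∀ s → Feasible G s →
                ∃[ s′ ] Feasible H s′ × value H s′ ≡ value G s

  ∣_∣ˢ_ : Solution → Graph → ℕ
  ∣ s ∣ˢ G = ∥ encode (shortName G) s ∥

open OptProblem public

AtLeastAsGood : Goal → ℕ → ℕ → Set
AtLeastAsGood minimize a b = a ≤ b
AtLeastAsGood maximize a b = b ≤ a

-- The optimum in the absence of feasible solutions.
infeasible : Goal → ℤ ±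
infeasible minimize = ⊤±
infeasible maximize = ⊥±

-- OPT as a relation (it has at most one value): whether a feasible
-- solution exists need not be decidable for an arbitrary problem.
IsOPT : ∀ {goal} → OptProblem goal → Graph → ℤ ± → Set
IsOPT {goal} Π G x =
  (∃[ s ] Feasible Π G s × x ≡ [ + value Π G s ] ×
     (∀ s′ → Feasible Π G s′ → AtLeastAsGood goal (value Π G s) (value Π G s′)))
  ⊎ ((∀ s → ¬ Feasible Π G s) × x ≡ infeasible goal)

infixl 6 _+±_

_+±_ : ℤ ± → ℤ → ℤ ±
⊥±    +± Δ = ⊥±
[ z ] +± Δ = [ z ℤ.+ Δ ]
⊤±    +± Δ = ⊤±

-- OPT (G ⊕ H) = OPT (G′ ⊕ H) + Δ for every H_B. Since gluing is defined
-- only for graphs that share no vertices outside the boundaries, H ranges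
-- over the boundaried graphs for which both sides make sense.
HasOffset : ∀ {goal B} → OptProblem goal → BoundariedGraph B → BoundariedGraph B → ℤ → Set
HasOffset {B = B} Π G G′ Δ =
  (H : BoundariedGraph B) → Gluable G H → Gluable G′ H →
  ∀ x → IsOPT Π (G ⊕ H) (x +± Δ) ⇔ IsOPT Π (G′ ⊕ H) x

GluingEquivalent : ∀ {goal B} → OptProblem goal → BoundariedGraph B → BoundariedGraph B → Set
GluingEquivalent Π G G′ = ∃[ Δ ] HasOffset Π G G′ Δ

------------------------------------------------------------------------
-- Boundaried kernelization

record KernelOutput {goal} (Π : OptProblem goal) (ρ : OptProblem minimize)
                    (f : ℕ → ℕ) {B : List Name} (G : BoundariedGraph B)
                    (s : Solution ρ) : Set where
  field
    G′         : BoundariedGraph B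
    s′         : Solution ρ
    s′-sol     : Feasible ρ (graph G′) s′
    equivalent : GluingEquivalent Π G G′

  parameter : ℕ
  parameter = length B + value ρ (graph G) s

  field
    G′-size  : ∣ graph G′ ∣ᴳ ≤ f parameter
    s′-size  : ∣_∣ˢ_ ρ s′ (graph G′) ≤ f parameter
    s′-value : value ρ (graph G′) s′ ≤ f parameter

  Δ : ℤ
  Δ = proj₁ equivalent

  encoded : Data
  encoded = encodeBoundariedGraph encodeName G′ ∙ encode ρ encodeName s′ ∙ encodeℤ Δ

encodeInput : ∀ {B} (ρ : OptProblem minimize) → BoundariedGraph B → Solution ρ → Data
encodeInput ρ G s = encodeBoundariedGraph encodeName G ∙ encode ρ encodeName s

record BoundariedKernelization {goal} (Π : OptProblem goal) (ρ : OptProblem minimize)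
                               (f : ℕ → ℕ) : Set where
  field
    program  : Program
    time     : ℕ → ℕ
    polytime : PolynomiallyBounded time
    output   : ∀ {B} (G : BoundariedGraph B) (s : Solution ρ) →
               Feasible ρ (graph G) s → KernelOutput Π ρ f G s
    computed : ∀ {B} (G : BoundariedGraph B) (s : Solution ρ)
               (sol : Feasible ρ (graph G) s) →
               Computes program ⟨ encodeInput ρ G s ⟩ KernelOutput.encoded (output G s sol)
                 within time ∥ encodeInput ρ G s ∥

-- Computability of the size bound f is not demanded separately: f is in any
-- case bounded by the computable function c * n ^ d + c, which is then also
-- a size bound.
record PolynomialBoundariedKernelization {goal} (Π : OptProblem goal)
                                         (ρ : OptProblem minimize) : Set where
  field
    size           : ℕ → ℕ
    polysize       : PolynomiallyBounded size
    kernelization  : BoundariedKernelization Π ρ size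

  open BoundariedKernelization kernelization public

  #outputVertices : ∀ {B} (G : BoundariedGraph B) (s : Solution ρ) →
                    Feasible ρ (graph G) s → ℕ
  #outputVertices G s sol = length (V (graph (KernelOutput.G′ (output G s sol))))

-- "The output graph has O(g(|B| + k)) vertices." As usual for O, the bound
-- applies from some threshold on; at |B| + k = 0 a quadratic bound without
-- threshold would force an empty output graph.
HasOutputVertices-O : ∀ {goal} {Π : OptProblem goal} {ρ : OptProblem minimize} →
                      PolynomialBoundariedKernelization Π ρ → (ℕ → ℕ) → Set
HasOutputVertices-O {ρ = ρ} K g =
  ∃[ c ] ∃[ n₀ ] ∀ {B} (G : BoundariedGraph B) (s : Solution ρ)
    (sol : Feasible ρ (graph G) s) →
    let k = value ρ (graph G) s in
    n₀ ≤ length B + k → #outputVertices G s sol ≤ c * g (length B + k)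
  where open PolynomialBoundariedKernelization K

------------------------------------------------------------------------
-- Long Path and Vertex Cover

IsPath : Graph → List Name → Set
IsPath G p = p ≢ [] × Unique p × All (_∈ V G) p × Linked (Adj G) p

IsVertexCover : Graph → List Name → Set
IsVertexCover G S = Unique S × All (_∈ V G) S × Edgeless (G − S)

unique-map : ∀ {G H} (φ : G ≅ H) {xs} → All (_∈ V G) xs → Unique xs →
             Unique (map (_≅_.to φ) xs)
unique-map φ [] [] = []
unique-map φ (x∈ ∷ xs∈) (x∉ ∷ xs!) =
  Allₚ.map⁺ (All.zipWith
    (λ (y∈ , x≢y) eq →
      x≢y (trans (sym (from-to x∈)) (trans (cong from eq) (from-to y∈))))
    (xs∈ , x∉))
  ∷ unique-map φ xs∈ xs!
  where open _≅_ φ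

path-invariant : ∀ {G H} → G ≅ H → ∀ p → IsPath G p →
                 ∃[ p′ ] IsPath H p′ × length p′ ∸ 1 ≡ length p ∸ 1
path-invariant φ p (p≢[] , p! , p⊆V , linked) =
  map to p ,
  (nonempty p p≢[] , unique-map φ p⊆V p! , Allₚ.map⁺ (All.map to-V p⊆V) ,
   Linkedₚ.map⁺ (Linked.map to-Adj linked)) ,
  cong (_∸ 1) (length-map to p)
  where
  open _≅_ φ
  nonempty : ∀ q → q ≢ [] → map to q ≢ []
  nonempty []      q≢[] _  = q≢[] refl
  nonempty (_ ∷ _) _    ()

Adj-V : ∀ G {u v} → Adj G u v → u ∈ V G × v ∈ V G
Adj-V G (inj₁ e∈) = let u∈ , v∈ , _ = All.lookup (E-simple G) e∈ in u∈ , v∈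
Adj-V G (inj₂ e∈) = let v∈ , u∈ , _ = All.lookup (E-simple G) e∈ in u∈ , v∈

Adj-− : ∀ G S {u v} → Adj (G − S) u v → Adj G u v × u ∉ S × v ∉ S
Adj-− G S (inj₁ e∈) =
  let e∈E , u∉ , v∉ =
        ∈-filter⁻ (λ e → ¬? (proj₁ e ∈? S) ×-dec ¬? (proj₂ e ∈? S)) {xs = E G} e∈
  in inj₁ e∈E , u∉ , v∉
Adj-− G S (inj₂ e∈) =
  let e∈E , v∉ , u∉ =
        ∈-filter⁻ (λ e → ¬? (proj₁ e ∈? S) ×-dec ¬? (proj₂ e ∈? S)) {xs = E G} e∈
  in inj₂ e∈E , u∉ , v∉

−-Adj : ∀ G S {u v} → Adj G u v → u ∉ S → v ∉ S → Adj (G − S) u v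
−-Adj G S (inj₁ e∈) u∉ v∉ =
  inj₁ (∈-filter⁺ (λ e → ¬? (proj₁ e ∈? S) ×-dec ¬? (proj₂ e ∈? S)) e∈ (u∉ , v∉))
−-Adj G S (inj₂ e∈) u∉ v∉ =
  inj₂ (∈-filter⁺ (λ e → ¬? (proj₁ e ∈? S) ×-dec ¬? (proj₂ e ∈? S)) e∈ (v∉ , u∉))

cover-invariant : ∀ {G H} → G ≅ H → ∀ S → IsVertexCover G S →
                  ∃[ S′ ] IsVertexCover H S′ × length S′ ≡ length S
cover-invariant {G} {H} φ S (S! , S⊆V , edgeless) =
  map to S ,
  (unique-map φ S⊆V S! , Allₚ.map⁺ (All.map to-V S⊆V) , edgeless′) ,
  length-map to S
  where
  open _≅_ φ
  pullback : ∀ {v} → v ∈ V H → v ∉ map to S → from v ∉ S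
  pullback v∈ v∉ fv∈ = v∉ (subst (_∈ map to S) (to-from v∈) (∈-map⁺ to fv∈))
  edgeless′ : Edgeless (H − map to S)
  edgeless′ u v adj =
    let adjH , u∉ , v∉ = Adj-− H (map to S) adj
        u∈ , v∈        = Adj-V H adjH
    in edgeless (from u) (from v)
         (−-Adj G S (from-Adj adjH) (pullback u∈ u∉) (pullback v∈ v∉))

LongPath : OptProblem maximize
LongPath = record
  { Solution  = List Name
  ; encode    = encodeList
  ; Feasible  = IsPath
  ; value     = λ _ p → length p ∸ 1
  ; invariant = path-invariant
  }

VertexCover : OptProblem minimize
VertexCover = record
  { Solution  = List Name
  ; encode    = encodeList
  ; Feasible  = IsVertexCover
  ; value     = λ _ S → length S
  ; invariant = cover-invariant
  }

{-# OPTIONS --safe --termination-depth=2 #-}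
-- A path of G ⊕ H meets the independent set I = V(G) ∖ (S ∪ B) in vertices that are
-- determined by pairwise distinct slots (predecessor, successor) in (S ∪ {none})², so it
-- matches these slots into I. An auction computes a matching of slots into I: an
-- unmatched vertex bids for an adjacent slot of least label, evicts its occupant and
-- raises the label by one; a vertex whose adjacent slots all have labels above the number
-- of slots is discarded. Some value g is then no label, and since an occupant of a slot
-- with label l sees only labels at least l - 1, the slots with label above g are closed:
-- their occupants and the discarded vertices are adjacent to no other slots. Hence the
-- vertices of any path on slots above g can be replaced by the occupants of these slots,
-- and deleting the discarded vertices changes no optimum. At most (|S| + 1)² vertices of
-- I remain.
module Submission where

open import Defs
open import Data.Bool using (Bool; true; false; _∧_) renaming (T to IsTrue)
open import Data.Fin using (Fin; zero; suc)
import Data.Integer as ℤ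
import Data.Integer.Properties as ℤₚ
import Data.List as List
open import Data.List using (List; []; _∷_; _++_; length; map; mapMaybe; filter; replicate; upTo; cartesianProduct)
import Data.List.Membership.DecPropositional as DecMembership
open import Data.List.Membership.Propositional using (_∈_; _∉_; find; lose)
open import Data.List.Membership.Propositional.Properties
  using (∈-∃++; ∈-map⁺; ∈-map⁻; ∈-++⁺ˡ; ∈-++⁺ʳ; ∈-++⁻; ∈-upTo⁻; ∈-filter⁺; ∈-filter⁻; ∈-cartesianProduct⁺)
open import Data.List.Properties using (length-++; length-map; length-upTo; length-filter; map-++; map-∘; map-id; ++-identityʳ)
open import Data.List.Relation.Binary.Permutation.Propositional
  using (_↭_; ↭-refl; ↭-reflexive; ↭-sym; ↭-trans; prep; swap; ↭⇒↭ₛ)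
open import Data.List.Relation.Binary.Permutation.Propositional.Properties using (∈-resp-↭; ↭-length; shift; ++⁺ˡ)
open import Data.List.Relation.Binary.Permutation.Setoid.Properties using (Unique-resp-↭)
open import Data.List.Relation.Unary.All as All using (All; []; _∷_)
import Data.List.Relation.Unary.All.Properties as Allₚ
open import Data.List.Relation.Unary.AllPairs as AllPairs using ([]; _∷_)
open import Data.List.Relation.Unary.Any using (Any; here; there; any?)
open import Data.List.Relation.Unary.Linked as Linked using (Linked; []; [-]; _∷_)
open import Data.List.Relation.Unary.Unique.Propositional using (Unique)
import Data.List.Relation.Unary.Unique.Propositional.Properties as Uniqueₚ
open import Data.Maybe using (Maybe; just; nothing; maybe′; fromMaybe)
open import Data.Maybe.Properties using (just-injective) renaming (≡-dec to Maybe-≡-dec)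
open import Data.Nat
open import Data.Nat.ListAction using (sum)
open import Data.Nat.Logarithm using (⌈log₂_⌉; ⌈log₂⌉-mono-≤; ⌈log₂2^n⌉≡n)
import Data.Nat.Properties as ℕₚ
open import Data.Nat.Properties hiding (_≟_)
open import Data.Nat.Tactic.RingSolver using (solve-∀)
open import Data.Product using (Σ-syntax; ∃-syntax; _×_; _,_; proj₁; proj₂)
open import Data.Product.Properties using () renaming (≡-dec to ×-≡-dec)
import Data.Sum as Sum
open import Data.Sum using (_⊎_; inj₁; inj₂)
open import Data.Unit using (⊤; tt)
open import Data.Vec as Vec using (Vec; []; _∷_)
open import Function using (id; _∘_)
open import Function.Bundles using (mk⇔)
open import Relation.Binary.Definitions using (DecidableEquality)
open import Relation.Binary.PropositionalEquality hiding ([_])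
open import Relation.Nullary using (¬_; Dec; yes; no; does; contradiction)
open import Relation.Nullary.Construct.Add.Extrema using (⊥±; ⊤±; [_])
open import Relation.Nullary.Decidable using (map′; ¬?; _×-dec_; does-⇔; dec-true; dec-false)
open NameMembership using (_∈?_)
open ≤-Reasoning

-- The gluing partner and its path are unknown when vertices are deleted, so one fixed replacement
-- rule must serve every path, whichever slots it uses. With `N` slots, some value among `0, ..., N`
-- is not a label, and since this gap `g` is at most `N`, a discarded vertex, which sees only labels
-- above `N`, falls on the closed side. An injection results because a vertex that stays in place is
-- adjacent to an open slot and so cannot occupy a closed one. The boundary is kept out of `I`
-- because the other graph may add edges there; outside it, all neighbours of a vertex of `I` lie in
-- `S` in every gluing. These neighbours are never replaced, so replacements at different places of
-- a path do not interfere. Rerouting preserves the number of vertices, and the output is a subgraph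
-- of the input, so the offset is 0 and the given cover is returned as it is.

Unique-⊆-length : {A : Set} {xs ys : List A} → Unique xs → All (_∈ ys) xs → length xs ≤ length ys
Unique-⊆-length [] [] = z≤n
Unique-⊆-length {xs = x ∷ xs} {ys} (x∉ ∷ xs!) (x∈ ∷ xs⊆) with as , bs , refl ← ∈-∃++ x∈ = begin
  suc (length xs)                ≤⟨ s≤s (Unique-⊆-length xs! (All.zipWith skip (x∉ , xs⊆))) ⟩
  suc (length (as ++ bs))        ≡⟨ cong suc (length-++ as) ⟩
  suc (length as + length bs)    ≡⟨ +-suc (length as) (length bs) ⟨
  length as + suc (length bs)    ≡⟨ length-++ as ⟨
  length ys                      ∎
  where
  skip : ∀ {y} → x ≢ y × y ∈ ys → y ∈ as ++ bs
  skip (x≢y , y∈) with ∈-++⁻ as y∈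
  ... | inj₁ y∈as         = ∈-++⁺ˡ y∈as
  ... | inj₂ (here refl)  = contradiction refl x≢y
  ... | inj₂ (there y∈bs) = ∈-++⁺ʳ as y∈bs

open DecMembership ℕₚ._≟_ using () renaming (_∈?_ to _∈ℕ?_)

-- Pigeonhole: there is one more candidate in `upTo (suc (length ls))` than there are entries of
-- `ls`.
gap : (ls : List ℕ) → ∃[ g ] g ≤ length ls × g ∉ ls
gap ls with All.all? (_∈ℕ? ls) (upTo (suc (length ls)))
... | yes all∈ = contradiction (Unique-⊆-length (Uniqueₚ.upTo⁺ (suc (length ls))) all∈)
                   (<⇒≱ (≤-reflexive (sym (length-upTo (suc (length ls))))))
... | no ¬all∈ with g , g∈ , g∉ ← find (Allₚ.¬All⇒Any¬ (_∈ℕ? ls) _ ¬all∈) = g , ≤-pred (∈-upTo⁻ g∈) , g∉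

Unique-++⁻ : {A : Set} → ∀ xs {ys : List A} → Unique (xs ++ ys) →
             Unique ys × (∀ {v} → v ∈ xs → v ∉ ys)
Unique-++⁻ []       ys!       = ys! , λ ()
Unique-++⁻ (x ∷ xs) (x∉ ∷ xs!) with ys! , disjoint ← Unique-++⁻ xs xs! = ys! , λ where
  (here refl) v∈ys → All.lookup x∉ (∈-++⁺ʳ xs v∈ys) refl
  (there v∈xs)     → disjoint v∈xs

-- Matching by auction

record Entry (K A : Set) : Set where
  constructor entry
  field
    key      : K
    label    : ℕ
    occupant : Maybe A

open Entry public

occupants : {K A : Set} → List (Entry K A) → List A
occupants = mapMaybe occupant

∈-occupants : ∀ {K A} {es : List (Entry K A)} {e v} → e ∈ es → occupant e ≡ just v → v ∈ occupants es
∈-occupants {es = entry _ _ .(just _) ∷ _} (here refl) refl = here refl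
∈-occupants {es = entry _ _ (just _) ∷ _} (there e∈) eq = there (∈-occupants e∈ eq)
∈-occupants {es = entry _ _ nothing ∷ _} (there e∈) eq = ∈-occupants e∈ eq

occupants-length : ∀ {K A} (es : List (Entry K A)) → length (occupants es) ≤ length es
occupants-length [] = z≤n
occupants-length (entry _ _ (just _) ∷ es) = s≤s (occupants-length es)
occupants-length (entry _ _ nothing ∷ es) = m≤n⇒m≤1+n (occupants-length es)

occupant-injective : ∀ {K A} {es : List (Entry K A)} {e e′ v} → Unique (occupants es) →
  e ∈ es → e′ ∈ es → occupant e ≡ just v → occupant e′ ≡ just v → e ≡ e′
occupant-injective {es = _ ∷ _} es! (here refl) (here refl) _ _ = refl
occupant-injective {es = entry _ _ (just _) ∷ _} (v∉ ∷ _) (here refl) (there e′∈) refl eq′ =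
  contradiction refl (All.lookup v∉ (∈-occupants e′∈ eq′))
occupant-injective {es = entry _ _ (just _) ∷ _} (v∉ ∷ _) (there e∈) (here refl) eq refl =
  contradiction refl (All.lookup v∉ (∈-occupants e∈ eq))
occupant-injective {es = entry _ _ (just _) ∷ _} (_ ∷ es!) (there e∈) (there e′∈) eq eq′ =
  occupant-injective es! e∈ e′∈ eq eq′
occupant-injective {es = entry _ _ nothing ∷ _} _ (there _) (here refl) _ ()
occupant-injective {es = entry _ _ nothing ∷ _} es! (there e∈) (there e′∈) eq eq′ =
  occupant-injective es! e∈ e′∈ eq eq′

-- This is all that rerouting needs from the auction. The rule sees one slot and one vertex and
-- knows nothing of the path around them; `injective` therefore ranges over all pairs that differ in
-- both components, as any two interior visits of a path do.
record Exchange {K A : Set} (_~_ : K → A → Set) (ks : List K) (I D : List A) : Set where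
  field
    exchange  : K → A → A
    valid     : ∀ {k v} → k ∈ ks → v ∈ I → k ~ v →
                exchange k v ∈ I × exchange k v ∉ D × k ~ exchange k v
    injective : ∀ {k v k′ v′} → k ∈ ks → k ~ v → k′ ∈ ks → k′ ~ v′ → k ≢ k′ → v ≢ v′ →
                exchange k v ≢ exchange k′ v′

module Auction {K A : Set} (_~_ : K → A → Set) where

  Entries : Set
  Entries = List (Entry K A)

  Match : A → ℕ → Entry K A → Set
  Match w ℓ e = label e ≡ ℓ × key e ~ w

  -- The refutation in `there` makes the first matching entry the claimed one, so the relation
  -- follows exactly the scan that the program performs.
  data Claim (w : A) (ℓ : ℕ) : Entries → Maybe A → Entries → Set where
    here  : ∀ {k o es} → k ~ w →
            Claim w ℓ (entry k ℓ o ∷ es) o (entry k (suc ℓ) (just w) ∷ es)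
    there : ∀ {e o es es′} → ¬ Match w ℓ e → Claim w ℓ es o es′ →
            Claim w ℓ (e ∷ es) o (e ∷ es′)

  claim? : (∀ k v → Dec (k ~ v)) → ∀ w ℓ es →
           (∃[ o ] ∃[ es′ ] Claim w ℓ es o es′) ⊎ All (λ e → ¬ Match w ℓ e) es
  claim? ~? w ℓ [] = inj₂ []
  claim? ~? w ℓ (e ∷ es) with (label e ℕₚ.≟ ℓ) ×-dec ~? (key e) w
  ... | yes (refl , k~w) = inj₁ (_ , _ , here k~w)
  ... | no ¬match with claim? ~? w ℓ es
  ...   | inj₁ (_ , _ , claim) = inj₁ (_ , _ , there ¬match claim)
  ...   | inj₂ ¬matches        = inj₂ (¬match ∷ ¬matches)

  claim-All : ∀ {w ℓ es o es′} {P Q : Entry K A → Set} → Claim w ℓ es o es′ →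
              (∀ {k o} → k ~ w → P (entry k ℓ o) → Q (entry k (suc ℓ) (just w))) →
              (∀ {e} → P e → Q e) → All P es → All Q es′
  claim-All (here k~w)  new old (p ∷ ps) = new k~w p ∷ All.map old ps
  claim-All (there _ c) new old (p ∷ ps) = old p ∷ claim-All c new old ps

  claim-keys : ∀ {w ℓ es o es′} → Claim w ℓ es o es′ → map key es′ ≡ map key es
  claim-keys (here _)    = refl
  claim-keys (there _ c) = cong (_ ∷_) (claim-keys c)

  evict : Maybe A → List A → List A
  evict = maybe′ _∷_ id

  evict-length : ∀ o q → length (evict o q) ≤ suc (length q)
  evict-length (just _) q = ≤-refl
  evict-length nothing  q = n≤1+n _

  evict-++ : ∀ o q xs → q ++ evict o xs ↭ evict o q ++ xs
  evict-++ (just v) q xs = shift _ q xs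
  evict-++ nothing  q xs = ↭-refl

  evict-∷ : ∀ o {u xs} → u ∷ evict o xs ↭ evict o (u ∷ xs)
  evict-∷ (just v) = swap _ _ ↭-refl
  evict-∷ nothing  = ↭-refl

  claim-↭ : ∀ {w ℓ es o es′} → Claim w ℓ es o es′ → w ∷ occupants es ↭ evict o (occupants es′)
  claim-↭ {o = just _}  (here _) = swap _ _ ↭-refl
  claim-↭ {o = nothing} (here _) = ↭-refl
  claim-↭ {es = entry _ _ nothing ∷ _} (there _ c) = claim-↭ c
  claim-↭ {es = entry _ _ (just u) ∷ _} {o} (there _ c) =
    ↭-trans (swap _ _ ↭-refl) (↭-trans (prep u (claim-↭ c)) (evict-∷ o))

  -- Run c q ℓ zs es D es∞ D∞: from the queue q, whose head is bidding at level ℓ, the slots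
  -- es and the discarded vertices D, the auction ends after c rounds with es∞ and D∞. The
  -- list zs only counts the levels above ℓ that remain to be tried.
  data Run : ℕ → List A → ℕ → Entries → Entries → List A → Entries → List A → Set where
    done    : ∀ {ℓ zs es D} → Run 0 [] ℓ zs es D es D
    claimed : ∀ {c w q ℓ zs es D o es′ es∞ D∞} → Claim w ℓ es o es′ →
              Run c (evict o q) 0 es′ es′ D es∞ D∞ → Run (suc c) (w ∷ q) ℓ zs es D es∞ D∞
    climb   : ∀ {c w q ℓ z zs es D es∞ D∞} → All (λ e → ¬ Match w ℓ e) es →
              Run c (w ∷ q) (suc ℓ) zs es D es∞ D∞ → Run (suc c) (w ∷ q) ℓ (z ∷ zs) es D es∞ D∞
    discard : ∀ {c w q ℓ es D es∞ D∞} → All (λ e → ¬ Match w ℓ e) es →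
              Run c q 0 es es (w ∷ D) es∞ D∞ → Run (suc c) (w ∷ q) ℓ [] es D es∞ D∞

  Above : ℕ → A → Entries → Set
  Above n w = All (λ e → key e ~ w → n ≤ label e)

  Above-0 : ∀ {w} es → Above 0 w es
  Above-0 es = All.tabulate λ _ _ → z≤n

  Above-suc : ∀ {n w es} → All (λ e → ¬ Match w n e) es → Above n w es → Above (suc n) w es
  Above-suc ¬matches above = All.zipWith (λ (¬match , n≤) k~w →
    ≤∧≢⇒< (n≤ k~w) λ { refl → ¬match (refl , k~w) }) (¬matches , above)

  -- Labels never decrease, so a lower bound that held when a vertex bid or was discarded survives
  -- all later claims.
  claim-Above : ∀ {w ℓ es o es′ n v} → Claim w ℓ es o es′ → Above n v es → Above n v es′
  claim-Above claim = claim-All claim (λ _ n≤ k~v → m≤n⇒m≤1+n (n≤ k~v)) id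

  -- `pred (label e)` is the level at which the present occupant made its claim: a label changes
  -- only together with the occupant.
  Settled : Entries → Entry K A → Set
  Settled es e = ∀ {v} → occupant e ≡ just v → key e ~ v × Above (pred (label e)) v es

  module _ (ks : List K) (I : List A) where

    N : ℕ
    N = length ks

    -- A claimed slot passes from occupant to occupant and is never emptied, hence `vacant`; it
    -- guarantees an occupant wherever the label is positive. For a duplicate-free `I`, the
    -- permutation in `partition` also makes the occupants distinct and disjoint from `D`.
    record Stable (q : List A) (es : Entries) (D : List A) : Set where
      field
        partition : D ++ q ++ occupants es ↭ I
        keys      : map key es ≡ ks
        settled   : All (Settled es) es
        vacant    : All (λ e → occupant e ≡ nothing → label e ≡ 0) es
        discarded : All (λ w → Above (suc N) w es) D

      size : length es ≡ N
      size = trans (sym (length-map key es)) (cong length keys)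

    open Stable

    -- Claims happen at levels at most `N` and leave labels at most `suc N`, so the truncated
    -- subtraction is exact where it matters and every claim costs exactly one unit.
    potential : Entries → ℕ
    potential es = sum (map (λ e → suc N ∸ label e) es)

    claim-potential : ∀ {w ℓ es o es′} → ℓ ≤ N → Claim w ℓ es o es′ →
                      potential es ≡ suc (potential es′)
    claim-potential {ℓ = ℓ} ℓ≤N (here {es = es} _) = cong (_+ potential es) (+-∸-assoc 1 ℓ≤N)
    claim-potential ℓ≤N (there {e} {es′ = es′} _ c) =
      trans (cong (suc N ∸ label e +_) (claim-potential ℓ≤N c)) (+-suc (suc N ∸ label e) (potential es′))

    claim-stable : ∀ {w ℓ q es o es′ D} → Claim w ℓ es o es′ → Above ℓ w es →
                   Stable (w ∷ q) es D → Stable (evict o q) es′ D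
    claim-stable {w} {ℓ} {q} {es} {o} {es′} {D} c above s = record
      { partition = ↭-trans (++⁺ˡ D (↭-trans (↭-sym (evict-++ o q (occupants es′)))
                      (↭-trans (++⁺ˡ q (↭-sym (claim-↭ c))) (shift _ q (occupants es))))) (partition s)
      ; keys      = trans (claim-keys c) (keys s)
      ; settled   = claim-All {P = Settled es} {Q = Settled es′} c (λ { k~w _ refl → k~w , claim-Above c above })
                      (λ settled eq → let k~v , low = settled eq in k~v , claim-Above c low)
                      (settled s)
      ; vacant    = claim-All c (λ { _ _ () }) id (vacant s)
      ; discarded = All.map (claim-Above c) (discarded s)
      }

    -- Lexicographic induction on `n` and `zs`. A claim lowers the potential by one without
    -- lengthening the queue, a discard shortens the queue, and a climb uses up an element of `zs`.
    -- Each unit of `n` thus pays for at most `suc N` rounds: `N` climbs and the claim or discard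
    -- that ends them. The table itself is the fresh counter, since it has `N` entries.
    auction : (∀ k v → Dec (k ~ v)) → ∀ n zs {q ℓ es D} →
              Stable q es D → (∀ {w q′} → q ≡ w ∷ q′ → Above ℓ w es) →
              ℓ + length zs ≡ N → length q + potential es ≤ n →
              ∃[ c ] ∃[ es∞ ] ∃[ D∞ ] Run c q ℓ zs es D es∞ D∞ × Stable [] es∞ D∞ ×
                c ≤ length zs + n * suc N
    auction ~? n zs {[]} s _ _ _ = 0 , _ , _ , done , s , z≤n
    auction ~? (suc n) zs {w ∷ q} {ℓ} {es} {D} s above level (s≤s q+Φ≤n) with claim? ~? w ℓ es
    ... | inj₁ (o , es′ , claim)
      with s′ ← claim-stable claim (above refl) s
      with c , es∞ , D∞ , run , s∞ , c≤ ← auction ~? n es′ {ℓ = 0} s′ (λ _ → Above-0 es′) (size s′) (begin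
             length (evict o q) + potential es′   ≤⟨ +-monoˡ-≤ (potential es′) (evict-length o q) ⟩
             suc (length q + potential es′)       ≡⟨ +-suc (length q) (potential es′) ⟨
             length q + suc (potential es′)       ≡⟨ cong (length q +_) (claim-potential (m+n≤o⇒m≤o ℓ (≤-reflexive level)) claim) ⟨
             length q + potential es              ≤⟨ q+Φ≤n ⟩
             n                                    ∎)
      = suc c , es∞ , D∞ , claimed claim run , s∞ ,
        ≤-trans (s≤s (subst (λ m → c ≤ m + n * suc N) (size s′) c≤)) (m≤n+m (suc n * suc N) (length zs))
    auction ~? (suc n) (z ∷ zs) {w ∷ q} {ℓ} {es} {D} s above level (s≤s q+Φ≤n) | inj₂ ¬matches
      with c , es∞ , D∞ , run , s∞ , c≤ ← auction ~? (suc n) zs {w ∷ q} {suc ℓ} s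
             (λ { refl → Above-suc ¬matches (above refl) }) (trans (sym (+-suc ℓ (length zs))) level) (s≤s q+Φ≤n)
      = suc c , es∞ , D∞ , climb ¬matches run , s∞ , s≤s c≤
    auction ~? (suc n) [] {w ∷ q} {ℓ} {es} {D} s above level (s≤s q+Φ≤n) | inj₂ ¬matches
      with c , es∞ , D∞ , run , s∞ , c≤ ← auction ~? n es {q} {0} {es} {w ∷ D} (record
             { partition = ↭-trans (↭-sym (shift _ D (q ++ occupants es))) (partition s)
             ; keys      = keys s
             ; settled   = settled s
             ; vacant    = vacant s
             -- The counter is empty, so `ℓ` equals `N`, and the failed bid at this last level
             -- raises the bound to `suc N`.
             ; discarded = subst (λ m → Above (suc m) w es) (trans (sym (+-identityʳ ℓ)) level)
                             (Above-suc ¬matches (above refl)) ∷ discarded s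
             }) (λ _ → Above-0 es) (size s) q+Φ≤n
      = suc c , es∞ , D∞ , discard ¬matches run , s∞ ,
        s≤s (subst (λ m → c ≤ m + n * suc N) (size s) c≤)

    -- The exchange property of the final state

    module _ (_≟_ : DecidableEquality K) (I! : Unique I) {es D} (s : Stable [] es D) where

      private
        g : ℕ
        g = proj₁ (gap (map label es))

        g≤N : g ≤ N
        g≤N = subst (g ≤_) (trans (length-map label es) (size s)) (proj₁ (proj₂ (gap (map label es))))

        label≢g : ∀ {e} → e ∈ es → label e ≢ g
        label≢g e∈ refl = proj₂ (proj₂ (gap (map label es))) (∈-map⁺ label e∈)

        high? : ∀ k → Dec (Any (λ e → key e ≡ k × g < label e) es)
        high? k = any? (λ e → (key e ≟ k) ×-dec (g <? label e)) es

        reassign : K → A → A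
        reassign k v with high? k
        -- The default `v` is never taken: a label above `g` is positive, and vacant slots have
        -- label 0.
        ... | yes high = fromMaybe v (occupant (proj₁ (find high)))
        ... | no  _    = v

        -- The graph of `reassign`, with the reason for each outcome attached, so that validity and
        -- injectivity become case distinctions on these reasons.
        data Reassigned (k : K) (v : A) : A → Set where
          moved : ∀ {e v′} → e ∈ es → key e ≡ k → g < label e → occupant e ≡ just v′ → Reassigned k v v′
          kept  : (∀ {e} → e ∈ es → key e ≡ k → label e ≤ g) → Reassigned k v v

        reassigned : ∀ k v → Reassigned k v (reassign k v)
        reassigned k v with high? k
        ... | no ¬high = kept λ e∈ k≡ → ≮⇒≥ λ g< → ¬high (lose e∈ (k≡ , g<))
        ... | yes high with e , e∈ , k≡ , g< ← find high with occupant e in eq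
        ...   | just _  = moved e∈ k≡ g< eq
        ...   | nothing = contradiction (subst (g <_) (All.lookup (vacant s) e∈ eq) g<) n≮0

        -- The slots with label above the gap g are closed: a vertex that occupies one has
        -- no neighbour with label g - 1 or less, hence none with label g or less.
        closed : ∀ {e e′ v} → e ∈ es → g < label e → occupant e ≡ just v →
                 e′ ∈ es → key e′ ~ v → g < label e′
        closed e∈ g< eq e′∈ k′~v =
          ≤∧≢⇒< (≤-trans (<⇒≤pred g<) (All.lookup (proj₂ (All.lookup (settled s) e∈ eq)) e′∈ k′~v))
                (label≢g e′∈ ∘ sym)

        entryOf : ∀ {k} → k ∈ ks → ∃[ e ] e ∈ es × key e ≡ k
        entryOf k∈ with e , e∈ , k≡ ← ∈-map⁻ key (subst (_ ∈_) (sym (keys s)) k∈) = e , e∈ , sym k≡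

        all! : Unique (D ++ occupants es)
        all! = Unique-resp-↭ (setoid A) (↭⇒↭ₛ (↭-sym (partition s))) I!

        -- A moved vertex is an occupant and thus not discarded. A kept one is adjacent to a slot
        -- with label at most `g`, hence at most `N`, which no discarded vertex is.
        valid : ∀ {k v v′} → k ∈ ks → v ∈ I → k ~ v → Reassigned k v v′ → v′ ∈ I × v′ ∉ D × k ~ v′
        valid k∈ v∈ k~v (moved e∈ refl g< eq) =
          ∈-resp-↭ (partition s) (∈-++⁺ʳ D v′∈) , (λ v∈D → proj₂ (Unique-++⁻ D all!) v∈D v′∈) ,
          proj₁ (All.lookup (settled s) e∈ eq)
          where v′∈ = ∈-occupants e∈ eq
        valid k∈ v∈ k~v (kept low) with e , e∈ , refl ← entryOf k∈ =
          v∈ , (λ v∈D → <⇒≱ (All.lookup (All.lookup (discarded s) v∈D) e∈ k~v) (≤-trans (low e∈ refl) g≤N)) , k~v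

        -- Different slots have different occupants, which settles two moves. In the mixed cases the
        -- common vertex would occupy a closed slot and yet be adjacent to one that is not closed.
        injective : ∀ {k v k′ v′ u} → k ∈ ks → k ~ v → k′ ∈ ks → k′ ~ v′ → k ≢ k′ → v ≢ v′ →
                    Reassigned k v u → ¬ Reassigned k′ v′ u
        injective _ _ _ _ k≢ _ (moved e∈ refl _ eq) (moved e′∈ refl _ eq′) =
          k≢ (cong key (occupant-injective (proj₁ (Unique-++⁻ D all!)) e∈ e′∈ eq eq′))
        injective _ _ k′∈ k′~v _ _ (moved e∈ _ g< eq) (kept low) with e′ , e′∈ , refl ← entryOf k′∈ =
          <⇒≱ (closed e∈ g< eq e′∈ k′~v) (low e′∈ refl)
        injective k∈ k~v _ _ _ _ (kept low) (moved e∈ _ g< eq) with e′ , e′∈ , refl ← entryOf k∈ =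
          <⇒≱ (closed e∈ g< eq e′∈ k~v) (low e′∈ refl)
        injective _ _ _ _ _ v≢ (kept _) (kept _) = v≢ refl

      stable-exchange : Exchange _~_ ks I D
      stable-exchange = record
        { exchange  = reassign
        ; valid     = λ k∈ v∈ k~v → valid k∈ v∈ k~v (reassigned _ _)
        ; injective = λ {k} {v} {k′} {v′} k∈ k~v k′∈ k′~v′ k≢ v≢ eq →
            injective k∈ k~v k′∈ k′~v′ k≢ v≢ (reassigned k v)
              (subst (Reassigned k′ v′) (sym eq) (reassigned k′ v′))
        }

-- Gluing

adj-sym : ∀ G {u v} → Adj G u v → Adj G v u
adj-sym _ (inj₁ e∈) = inj₂ e∈
adj-sym _ (inj₂ e∈) = inj₁ e∈

adj-irreflexive : ∀ G {u} → ¬ Adj G u u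
adj-irreflexive G (inj₁ e∈) = proj₂ (proj₂ (All.lookup (E-simple G) e∈)) refl
adj-irreflexive G (inj₂ e∈) = proj₂ (proj₂ (All.lookup (E-simple G) e∈)) refl

without : List Name → List Name → List Name
without xs D = filter (λ v → ¬? (v ∈? D)) xs

∈-without⁺ : ∀ {v xs D} → v ∈ xs → v ∉ D → v ∈ without xs D
∈-without⁺ = ∈-filter⁺ (λ v → ¬? (v ∈? _))

∈-without⁻ : ∀ {v xs D} → v ∈ without xs D → v ∈ xs × v ∉ D
∈-without⁻ = ∈-filter⁻ (λ v → ¬? (v ∈? _))

module _ {B C} (G : BoundariedGraph B) (H : BoundariedGraph C) where

  ⊕-V⁺ˡ : ∀ {v} → v ∈ V (graph G) → v ∈ V (G ⊕ H)
  ⊕-V⁺ˡ = ∈-++⁺ˡ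

  ⊕-V⁺ʳ : ∀ {v} → v ∈ V (graph H) → v ∈ V (G ⊕ H)
  ⊕-V⁺ʳ {v} v∈ with v ∈? V (graph G)
  ... | yes v∈G = ∈-++⁺ˡ v∈G
  ... | no  v∉G = ∈-++⁺ʳ (V (graph G)) (∈-without⁺ v∈ v∉G)

  ⊕-V⁻ : ∀ {v} → v ∈ V (G ⊕ H) → v ∈ V (graph G) ⊎ v ∈ V (graph H)
  ⊕-V⁻ v∈ with ∈-++⁻ (V (graph G)) v∈
  ... | inj₁ v∈G = inj₁ v∈G
  ... | inj₂ v∈H = inj₂ (proj₁ (∈-without⁻ {xs = V (graph H)} v∈H))

  private
    newE? = λ (e : Name × Name) → ¬? (adj? (graph G) (proj₁ e) (proj₂ e))

    edge⁻ : ∀ {e} → e ∈ E (G ⊕ H) → e ∈ E (graph G) ⊎ e ∈ E (graph H)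
    edge⁻ e∈ with ∈-++⁻ (E (graph G)) e∈
    ... | inj₁ e∈G = inj₁ e∈G
    ... | inj₂ e∈H = inj₂ (proj₁ (∈-filter⁻ newE? {xs = E (graph H)} e∈H))

  ⊕-Adj⁺ˡ : ∀ {u v} → Adj (graph G) u v → Adj (G ⊕ H) u v
  ⊕-Adj⁺ˡ (inj₁ e∈) = inj₁ (∈-++⁺ˡ e∈)
  ⊕-Adj⁺ˡ (inj₂ e∈) = inj₂ (∈-++⁺ˡ e∈)

  ⊕-Adj⁺ʳ : ∀ {u v} → Adj (graph H) u v → Adj (G ⊕ H) u v
  ⊕-Adj⁺ʳ {u} {v} adj with adj? (graph G) u v
  ⊕-Adj⁺ʳ adj        | yes adjG = ⊕-Adj⁺ˡ adjG
  ⊕-Adj⁺ʳ (inj₁ e∈) | no ¬adjG = inj₁ (∈-++⁺ʳ (E (graph G)) (∈-filter⁺ newE? e∈ ¬adjG))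
  ⊕-Adj⁺ʳ (inj₂ e∈) | no ¬adjG =
    inj₂ (∈-++⁺ʳ (E (graph G)) (∈-filter⁺ newE? e∈ (¬adjG ∘ adj-sym (graph G))))

  ⊕-Adj⁻ : ∀ {u v} → Adj (G ⊕ H) u v → Adj (graph G) u v ⊎ Adj (graph H) u v
  ⊕-Adj⁻ (inj₁ e∈) = Sum.map inj₁ inj₁ (edge⁻ e∈)
  ⊕-Adj⁻ (inj₂ e∈) = Sum.map inj₂ inj₂ (edge⁻ e∈)

-- Neighbours on a path, with nothing standing for a missing neighbour

Slot : Set
Slot = Maybe Name × Maybe Name

EndAdj : Graph → Maybe Name → Name → Set
EndAdj G nothing  v = ⊤
EndAdj G (just a) v = Adj G v a

endAdj? : ∀ G a v → Dec (EndAdj G a v)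
endAdj? G nothing  v = yes tt
endAdj? G (just a) v = adj? G v a

SlotAdj : Graph → Slot → Name → Set
SlotAdj G (a , b) v = EndAdj G a v × EndAdj G b v

slotAdj? : ∀ G k v → Dec (SlotAdj G k v)
slotAdj? G (a , b) v = endAdj? G a v ×-dec endAdj? G b v

ends : List Name → List (Maybe Name)
ends S = map just S ++ nothing ∷ []

slots : List Name → List Slot
slots S = cartesianProduct (ends S) (ends S)

-- Removing `B` as well makes these vertices private to `G`: gluing gives them no new edges.
interior : ∀ {B} → BoundariedGraph B → List Name → List Name
interior {B} G S = without (without (V (graph G)) S) B

-- Deleting discarded interior vertices

module Deletion {B} (G : BoundariedGraph B) {S} (cover : IsVertexCover (graph G) S)
                {D} (D⊆I : ∀ {v} → v ∈ D → v ∈ interior G S) where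

  I : List Name
  I = interior G S

  interior⁻ : ∀ {v} → v ∈ I → v ∈ V (graph G) × v ∉ S × v ∉ B
  interior⁻ v∈ with v∈′ , v∉B ← ∈-without⁻ {xs = without (V (graph G)) S} v∈
               with v∈V , v∉S ← ∈-without⁻ {xs = V (graph G)} v∈′ = v∈V , v∉S , v∉B

  G′ : BoundariedGraph B
  G′ = record
    { graph    = graph G − D
    ; B-unique = B-unique G
    ; B⊆V      = All.tabulate λ b∈ → ∈-without⁺ (All.lookup (B⊆V G) b∈)
                   λ b∈D → proj₂ (proj₂ (interior⁻ (D⊆I b∈D))) b∈
    }

  interior-neighbour : ∀ {v a} → v ∈ I → Adj (graph G) v a → a ∈ S
  interior-neighbour {v} {a} v∈I adj with a ∈? S
  ... | yes a∈S = a∈S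
  ... | no  a∉S = contradiction (−-Adj (graph G) S adj (proj₁ (proj₂ (interior⁻ v∈I))) a∉S)
                    (proj₂ (proj₂ cover) v a)

  cover′ : IsVertexCover (graph G′) S
  cover′ = proj₁ cover ,
    All.tabulate (λ s∈ → ∈-without⁺ (All.lookup (proj₁ (proj₂ cover)) s∈)
      λ s∈D → proj₁ (proj₂ (interior⁻ (D⊆I s∈D))) s∈) ,
    λ u v adj → let adj′ , u∉ , v∉ = Adj-− (graph G − D) S adj
                    adjG , _ , _ = Adj-− (graph G) D adj′
                in proj₂ (proj₂ cover) u v (−-Adj (graph G) S adjG u∉ v∉)

  module Gluing (exchange : Exchange (SlotAdj (graph G)) (slots S) I D)
                (H : BoundariedGraph B) (gluable : Gluable G H) where

    open Exchange exchange renaming (exchange to substitute)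

    GH G′H : Graph
    GH  = G ⊕ H
    G′H = G′ ⊕ H

    interior-∉H : ∀ {v} → v ∈ I → v ∉ V (graph H)
    interior-∉H v∈I v∈H with v∈G , _ , v∉B ← interior⁻ v∈I = v∉B (proj₁ (gluable v∈G v∈H))

    Adj-interior : ∀ {v a} → v ∈ I → Adj GH v a → Adj (graph G) v a
    Adj-interior v∈I adj with ⊕-Adj⁻ G H adj
    ... | inj₁ adjG = adjG
    ... | inj₂ adjH = contradiction (proj₁ (Adj-V (graph H) adjH)) (interior-∉H v∈I)

    V-kept : ∀ {v} → v ∈ V GH → v ∉ D → v ∈ V G′H
    V-kept v∈ v∉D with ⊕-V⁻ G H v∈
    ... | inj₁ v∈G = ⊕-V⁺ˡ G′ H (∈-without⁺ v∈G v∉D)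
    ... | inj₂ v∈H = ⊕-V⁺ʳ G′ H v∈H

    Adj-kept : ∀ {u v} → Adj GH u v → u ∉ D → v ∉ D → Adj G′H u v
    Adj-kept adj u∉D v∉D with ⊕-Adj⁻ G H adj
    ... | inj₁ adjG = ⊕-Adj⁺ˡ G′ H (−-Adj (graph G) D adjG u∉D v∉D)
    ... | inj₂ adjH = ⊕-Adj⁺ʳ G′ H adjH

    V-back : ∀ {v} → v ∈ V G′H → v ∈ V GH
    V-back v∈ with ⊕-V⁻ G′ H v∈
    ... | inj₁ v∈G = ⊕-V⁺ˡ G H (proj₁ (∈-without⁻ {xs = V (graph G)} v∈G))
    ... | inj₂ v∈H = ⊕-V⁺ʳ G H v∈H

    Adj-back : ∀ {u v} → Adj G′H u v → Adj GH u v
    Adj-back adj with ⊕-Adj⁻ G′ H adj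
    ... | inj₁ adjG = ⊕-Adj⁺ˡ G H (proj₁ (Adj-− (graph G) D adjG))
    ... | inj₂ adjH = ⊕-Adj⁺ʳ G H adjH

    -- Rerouting a path of the glued graph

    record Visit (a : Maybe Name) (v : Name) (b : Maybe Name) : Set where
      constructor visit
      field
        before : EndAdj GH a v
        inside : v ∈ V GH
        after  : EndAdj GH b v

    open Visit

    EndAdj-interior : ∀ a {v} → v ∈ I → EndAdj GH a v → EndAdj (graph G) a v × a ∈ ends S
    EndAdj-interior nothing  v∈I _   = tt , ∈-++⁺ʳ (map just S) (here refl)
    EndAdj-interior (just a) v∈I adj with adjG ← Adj-interior v∈I adj =
      adjG , ∈-++⁺ˡ (∈-map⁺ just (interior-neighbour v∈I adjG))

    visit-slot : ∀ {a v b} → v ∈ I → Visit a v b → SlotAdj (graph G) (a , b) v × (a , b) ∈ slots S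
    visit-slot {a} {b = b} v∈I (visit before _ after)
      with adj-a , a∈ ← EndAdj-interior a v∈I before
         | adj-b , b∈ ← EndAdj-interior b v∈I after
      = (adj-a , adj-b) , ∈-cartesianProduct⁺ a∈ b∈

    visit-valid : ∀ {a v b} → v ∈ I → Visit a v b →
                  substitute (a , b) v ∈ I × substitute (a , b) v ∉ D × SlotAdj (graph G) (a , b) (substitute (a , b) v)
    visit-valid v∈I t with adj , k∈ ← visit-slot v∈I t = valid k∈ v∈I adj

    -- The new vertex depends only on the old one and its two neighbours on the path, so rerouting
    -- is a local operation.
    replace : Maybe Name → Name → Maybe Name → Name
    replace a v b with v ∈? I
    ... | yes _ = substitute (a , b) v
    ... | no  _ = v

    replace-∉D : ∀ {a v b} → Visit a v b → replace a v b ∉ D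
    replace-∉D {v = v} t with v ∈? I
    ... | yes v∈I = proj₁ (proj₂ (visit-valid v∈I t))
    ... | no  v∉I = v∉I ∘ D⊆I

    replace-V : ∀ {a v b} → Visit a v b → replace a v b ∈ V G′H
    replace-V {a} {v} {b} t = V-kept inGH (replace-∉D t)
      where
      inGH : replace a v b ∈ V GH
      inGH with v ∈? I
      ... | yes v∈I = ⊕-V⁺ˡ G H (proj₁ (interior⁻ (proj₁ (visit-valid v∈I t))))
      ... | no  v∉I = inside t

    -- Consecutive vertices of a path are not both in `I`, as `I` is independent. If one of them is
    -- replaced, the other is an end of its slot and stays, and the replacement is adjacent to it by
    -- the choice of slot.
    replace-Adj : ∀ {a v w b} → Visit a v (just w) → Visit (just v) w b →
                  Adj G′H (replace a v (just w)) (replace (just v) w b)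
    replace-Adj {a} {v} {w} {b} t t′ = Adj-kept adjGH (replace-∉D t) (replace-∉D t′)
      where
      adjGH : Adj GH (replace a v (just w)) (replace (just v) w b)
      adjGH with v ∈? I | w ∈? I
      ... | yes v∈I | yes w∈I = contradiction (interior-neighbour v∈I (Adj-interior v∈I (after t)))
                                  (proj₁ (proj₂ (interior⁻ w∈I)))
      ... | yes v∈I | no  w∉I = ⊕-Adj⁺ˡ G H (proj₂ (proj₂ (proj₂ (visit-valid v∈I t))))
      ... | no  v∉I | yes w∈I = ⊕-Adj⁺ˡ G H (adj-sym (graph G) (proj₁ (proj₂ (proj₂ (visit-valid w∈I t′)))))
      ... | no  v∉I | no  w∉I = after t

    -- Different predecessors already force different slots. If only one of the two vertices is
    -- interior, its replacement lies in `I` and the other vertex does not.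
    replace-injective : ∀ {a v b a′ v′ b′} → Visit a v b → Visit a′ v′ b′ → a ≢ a′ → v ≢ v′ →
                        replace a v b ≢ replace a′ v′ b′
    replace-injective {v = v} {v′ = v′} t t′ a≢ v≢ eq with v ∈? I | v′ ∈? I
    ... | yes v∈I | yes v′∈I with adj , k∈ ← visit-slot v∈I t | adj′ , k′∈ ← visit-slot v′∈I t′ =
      injective k∈ adj k′∈ adj′ (a≢ ∘ cong proj₁) v≢ eq
    ... | yes v∈I | no  v′∉I = v′∉I (subst (_∈ I) eq (proj₁ (visit-valid v∈I t)))
    ... | no  v∉I | yes v′∈I = v∉I (subst (_∈ I) (sym eq) (proj₁ (visit-valid v′∈I t′)))
    ... | no  v∉I | no  v′∉I = v≢ eq

    -- The predecessor handed on is the one on the old path. It agrees with the new predecessor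
    -- whenever `v` is interior, since it then lies in `S`.
    reroute : Maybe Name → List Name → List Name
    reroute a []      = []
    reroute a (v ∷ p) = replace a v (List.head p) ∷ reroute (just v) p

    reroute-length : ∀ a p → length (reroute a p) ≡ length p
    reroute-length a []      = refl
    reroute-length a (v ∷ p) = cong suc (reroute-length (just v) p)

    data Trail : Maybe Name → List Name → Set where
      []  : ∀ {a} → Trail a []
      _∷_ : ∀ {a v p} → Visit a v (List.head p) → Trail (just v) p → Trail a (v ∷ p)

    trail : ∀ {a v p} → EndAdj GH a v → All (_∈ V GH) (v ∷ p) → Linked (Adj GH) (v ∷ p) → Trail a (v ∷ p)
    trail before (v∈ ∷ [])   [-]        = visit before v∈ tt ∷ []
    trail before (v∈ ∷ p⊆V) (adj ∷ adjs) =
      visit before v∈ adj ∷ trail (adj-sym GH adj) p⊆V adjs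

    reroute-V : ∀ {a p} → Trail a p → All (_∈ V G′H) (reroute a p)
    reroute-V []      = []
    reroute-V (t ∷ ts) = replace-V t ∷ reroute-V ts

    reroute-Linked : ∀ {a p} → Trail a p → Linked (Adj G′H) (reroute a p)
    reroute-Linked []            = []
    reroute-Linked (t ∷ [])      = [-]
    reroute-Linked (t ∷ t′ ∷ ts) = replace-Adj t t′ ∷ reroute-Linked (t′ ∷ ts)

    -- The predecessors met along `p` are `u` followed by the vertices of `p` themselves; so the
    -- condition on `a` is consumed one position later than the condition on `v`.
    replace-≢ : ∀ {a v b u p} → Visit a v b → Trail (just u) p → a ≢ just u →
                All (λ w → a ≢ just w × v ≢ w) p → All (replace a v b ≢_) (reroute (just u) p)
    replace-≢ t []        _   []                  = []
    replace-≢ t (t′ ∷ ts) a≢u ((a≢w , v≢w) ∷ ≢s) = replace-injective t t′ a≢u v≢w ∷ replace-≢ t ts a≢w ≢s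

    reroute-Unique : ∀ {a p} → Trail a p → All (λ w → a ≢ just w) p → Unique p → Unique (reroute a p)
    reroute-Unique []      []         []          = []
    reroute-Unique (t ∷ ts) (a≢v ∷ a≢) (v∉ ∷ p!) =
      replace-≢ t ts a≢v (All.zip (a≢ , v∉)) ∷
      reroute-Unique ts (All.map (_∘ just-injective) v∉) p!

    forward : ∀ p → IsPath GH p → ∃[ p′ ] IsPath G′H p′ × length p′ ≡ length p
    forward []      (p≢[] , _) = contradiction refl p≢[]
    forward (v ∷ p) (_ , p! , p⊆V , linked) with ts ← trail {nothing} tt p⊆V linked =
      reroute nothing (v ∷ p) ,
      ((λ ()) , reroute-Unique ts (All.tabulate λ _ ()) p! , reroute-V ts , reroute-Linked ts) ,
      reroute-length nothing (v ∷ p)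

    backward : ∀ p → IsPath G′H p → IsPath GH p
    backward p (p≢[] , p! , p⊆V , linked) =
      p≢[] , p! , All.map V-back p⊆V , Linked.map Adj-back linked

    IsOPT-forward : ∀ {x} → IsOPT LongPath GH x → IsOPT LongPath G′H x
    IsOPT-forward (inj₁ (p , path , eq , best)) with p′ , path′ , len ← forward p path =
      inj₁ (p′ , path′ , trans eq (cong (λ n → [ ℤ.+ (n ∸ 1) ]) (sym len)) ,
            λ q q-path → subst (λ n → length q ∸ 1 ≤ n ∸ 1) (sym len) (best q (backward q q-path)))
    IsOPT-forward (inj₂ (none , eq)) = inj₂ ((λ p path → none p (backward p path)) , eq)

    IsOPT-backward : ∀ {x} → IsOPT LongPath G′H x → IsOPT LongPath GH x
    IsOPT-backward (inj₁ (p , path , eq , best)) =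
      inj₁ (p , backward p path , eq , λ q q-path → let q′ , q′-path , len = forward q q-path in
            subst (λ n → n ∸ 1 ≤ length p ∸ 1) len (best q′ q′-path))
    IsOPT-backward (inj₂ (none , eq)) =
      inj₂ ((λ p path → let p′ , path′ , _ = forward p path in none p′ path′) , eq)

  +±-identityʳ : ∀ x → x +± ℤ.+ 0 ≡ x
  +±-identityʳ ⊥±    = refl
  +±-identityʳ [ z ] = cong [_] (ℤₚ.+-identityʳ z)
  +±-identityʳ ⊤±    = refl

  hasOffset : Exchange (SlotAdj (graph G)) (slots S) I D → HasOffset LongPath G G′ (ℤ.+ 0)
  hasOffset exchange H gluable _ x =
    mk⇔ (λ opt → IsOPT-forward (subst (IsOPT LongPath (G ⊕ H)) (+±-identityʳ x) opt))
        (λ opt → subst (IsOPT LongPath (G ⊕ H)) (sym (+±-identityʳ x)) (IsOPT-backward opt))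
    where open Gluing exchange H gluable

-- Evaluation with time bounds

module Cost {m} (F : Vec (Exp m 1) m) where

  -- Running times are bounded by a numeral plus a symbolic part, so that the numerals
  -- add up by computation.
  record Evaluates {n} (ρ : Vec Data n) (e : Exp m n) (v : Data) (k T : ℕ) : Set where
    constructor evaluates
    field
      {time}     : ℕ
      derivation : F , ρ ⊢ e ⇓ v ⟨ time ⟩
      bound      : time ≤ k + T

  Calls : Fin m → Data → Data → ℕ → Set
  Calls f u v T = Evaluates (u ∷ []) (Vec.lookup F f) v 0 T

  private
    add : ∀ {t₁ t₂} k₁ {T₁} k₂ {T₂} → t₁ ≤ k₁ + T₁ → t₂ ≤ k₂ + T₂ → suc (t₁ + t₂) ≤ suc (k₁ + k₂) + (T₁ + T₂)
    add {t₁} {t₂} k₁ {T₁} k₂ {T₂} ≤₁ ≤₂ = s≤s (begin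
      t₁ + t₂                 ≤⟨ +-mono-≤ ≤₁ ≤₂ ⟩
      (k₁ + T₁) + (k₂ + T₂)   ≡⟨ +-assoc k₁ T₁ (k₂ + T₂) ⟩
      k₁ + (T₁ + (k₂ + T₂))   ≡⟨ cong (k₁ +_) (+-assoc T₁ k₂ T₂) ⟨
      k₁ + ((T₁ + k₂) + T₂)   ≡⟨ cong (λ n → k₁ + (n + T₂)) (+-comm T₁ k₂) ⟩
      k₁ + ((k₂ + T₁) + T₂)   ≡⟨ cong (k₁ +_) (+-assoc k₂ T₁ T₂) ⟩
      k₁ + (k₂ + (T₁ + T₂))   ≡⟨ +-assoc k₁ k₂ (T₁ + T₂) ⟨
      (k₁ + k₂) + (T₁ + T₂)   ∎)

  module _ {n} {ρ : Vec Data n} where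

    cons↓ : ∀ {e₁ e₂ v₁ v₂ k₁ k₂ T₁ T₂} → Evaluates ρ e₁ v₁ k₁ T₁ → Evaluates ρ e₂ v₂ k₂ T₂ →
            Evaluates ρ (cons e₁ e₂) (v₁ ∙ v₂) (suc (k₁ + k₂)) (T₁ + T₂)
    cons↓ {k₁ = k₁} {k₂} (evaluates d₁ ≤₁) (evaluates d₂ ≤₂) = evaluates (⇓cons d₁ d₂) (add k₁ k₂ ≤₁ ≤₂)

    true↓ : ∀ {e₀ e₁ e₂ a b v k₀ k T₀ T} → Evaluates ρ e₀ (a ∙ b) k₀ T₀ → Evaluates ρ e₁ v k T →
            Evaluates ρ (if e₀ then e₁ else e₂) v (suc (k₀ + k)) (T₀ + T)
    true↓ {k₀ = k₀} {k} (evaluates d₀ ≤₀) (evaluates d ≤₁) = evaluates (⇓true d₀ d) (add k₀ k ≤₀ ≤₁)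

    false↓ : ∀ {e₀ e₁ e₂ v k₀ k T₀ T} → Evaluates ρ e₀ nil k₀ T₀ → Evaluates ρ e₂ v k T →
             Evaluates ρ (if e₀ then e₁ else e₂) v (suc (k₀ + k)) (T₀ + T)
    false↓ {k₀ = k₀} {k} (evaluates d₀ ≤₀) (evaluates d ≤₁) = evaluates (⇓false d₀ d) (add k₀ k ≤₀ ≤₁)

    let↓ : ∀ {e₁ e₂ u v k₁ k₂ T₁ T₂} → Evaluates ρ e₁ u k₁ T₁ → Evaluates (u ∷ ρ) e₂ v k₂ T₂ →
           Evaluates ρ (let′ e₁ e₂) v (suc (k₁ + k₂)) (T₁ + T₂)
    let↓ {k₁ = k₁} {k₂} (evaluates d₁ ≤₁) (evaluates d₂ ≤₂) = evaluates (⇓let d₁ d₂) (add k₁ k₂ ≤₁ ≤₂)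

    call↓ : ∀ {f e u v k T₁ T₂} → Evaluates ρ e u k T₁ → Calls f u v T₂ →
            Evaluates ρ (call f e) v (suc (k + 0)) (T₁ + T₂)
    call↓ {k = k} (evaluates d₁ ≤₁) (evaluates d₂ ≤₂) = evaluates (⇓call d₁ d₂) (add k 0 ≤₁ ≤₂)

    -- The comparison of numerals computes to `true`, so the implicit argument is filled in without
    -- a proof at the call.
    weaken : ∀ {e v k T k′ T′} {k≤k′ : IsTrue (k ≤ᵇ k′)} → T ≤ T′ → Evaluates ρ e v k T → Evaluates ρ e v k′ T′
    weaken {k = k} {k′ = k′} {k≤k′ = k≤} T≤ (evaluates d ≤₁) =
      evaluates d (≤-trans ≤₁ (+-mono-≤ (≤ᵇ⇒≤ k k′ k≤) T≤))

    within : ∀ {e v k T T′} → k + T ≤ T′ → Evaluates ρ e v k T → Evaluates ρ e v 0 T′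
    within T≤ (evaluates d ≤₁) = evaluates d (≤-trans ≤₁ T≤)

  -- Expressions without branching, binding or calls have a value and an exact cost given by
  -- recursion; `basic↓` disposes of them by computation. The catch-all clauses of `eval` and
  -- `steps` are placeholders on the expressions rejected here.
  basic? : ∀ {n} → Exp m n → Bool
  basic? (var i)      = true
  basic? nil          = true
  basic? (cons e₁ e₂) = basic? e₁ ∧ basic? e₂
  basic? (hd e)       = basic? e
  basic? (tl e)       = basic? e
  basic? _            = false

  eval : ∀ {n} → Vec Data n → Exp m n → Data
  eval ρ (var i)      = Vec.lookup ρ i
  eval ρ (cons e₁ e₂) = eval ρ e₁ ∙ eval ρ e₂
  eval ρ (hd e)       = head (eval ρ e)
  eval ρ (tl e)       = tail (eval ρ e)
  eval ρ _            = nil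

  steps : ∀ {n} → Exp m n → ℕ
  steps (cons e₁ e₂) = suc (steps e₁ + steps e₂)
  steps (hd e)       = suc (steps e)
  steps (tl e)       = suc (steps e)
  steps _            = 1

  T-∧ˡ : ∀ {a b} → IsTrue (a ∧ b) → IsTrue a
  T-∧ˡ {true} _ = tt

  T-∧ʳ : ∀ {a b} → IsTrue (a ∧ b) → IsTrue b
  T-∧ʳ {true} b = b

  basic⇓ : ∀ {n} (ρ : Vec Data n) e → IsTrue (basic? e) → F , ρ ⊢ e ⇓ eval ρ e ⟨ steps e ⟩
  basic⇓ ρ (var i)      _ = ⇓var
  basic⇓ ρ nil          _ = ⇓nil
  basic⇓ ρ (cons e₁ e₂) b = ⇓cons (basic⇓ ρ e₁ (T-∧ˡ b)) (basic⇓ ρ e₂ (T-∧ʳ {basic? e₁} b))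
  basic⇓ ρ (hd e)       b = ⇓hd (basic⇓ ρ e b)
  basic⇓ ρ (tl e)       b = ⇓tl (basic⇓ ρ e b)

  basic↓ : ∀ {n} {ρ : Vec Data n} {e} {b : IsTrue (basic? e)} → Evaluates ρ e (eval ρ e) (steps e) 0
  basic↓ {ρ = ρ} {e} {b} = evaluates (basic⇓ ρ e b) (≤-reflexive (sym (+-identityʳ _)))

-- The program

pattern mainᶠ    = zero
pattern equalᶠ   = suc zero
pattern memberᶠ  = suc (suc zero)
pattern withoutᶠ = suc (suc (suc zero))
pattern edgesᶠ   = suc (suc (suc (suc zero)))
pattern endᶠ     = suc (suc (suc (suc (suc zero))))
pattern endsᶠ    = suc (suc (suc (suc (suc (suc zero)))))
pattern rowᶠ     = suc (suc (suc (suc (suc (suc (suc zero))))))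
pattern tableᶠ   = suc (suc (suc (suc (suc (suc (suc (suc zero)))))))
pattern claimᶠ   = suc (suc (suc (suc (suc (suc (suc (suc (suc zero))))))))
pattern auctionᶠ = suc (suc (suc (suc (suc (suc (suc (suc (suc (suc zero)))))))))

x₀ : ∀ {n} → Exp 11 (suc n)
x₀ = var zero

x₁ : ∀ {n} → Exp 11 (suc (suc n))
x₁ = var (suc zero)

x₂ : ∀ {n} → Exp 11 (suc (suc (suc n)))
x₂ = var (suc (suc zero))

x₃ : ∀ {n} → Exp 11 (suc (suc (suc (suc n))))
x₃ = var (suc (suc (suc zero)))

true′ : ∀ {n} → Exp 11 n
true′ = cons nil nil

equalᵇ memberᵇ withoutᵇ edgesᵇ endᵇ endsᵇ rowᵇ tableᵇ matchᵇ claimᵇ auctionᵇ mainᵇ : Exp 11 1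

-- The comment above a body shows the shape of its argument x₀.

-- a ∙ b
equalᵇ =
  if hd x₀ then
    (if tl x₀ then
      (if call equalᶠ (cons (hd (hd x₀)) (hd (tl x₀)))
       then call equalᶠ (cons (tl (hd x₀)) (tl (tl x₀)))
       else nil)
     else nil)
  else (if tl x₀ then nil else true′)

-- x ∙ xs
memberᵇ =
  if tl x₀ then
    (if call equalᶠ (cons (hd x₀) (hd (tl x₀))) then true′
     else call memberᶠ (cons (hd x₀) (tl (tl x₀))))
  else nil

-- xs ∙ D
withoutᵇ =
  if hd x₀ then
    (if call memberᶠ (cons (hd (hd x₀)) (tl x₀))
     then call withoutᶠ (cons (tl (hd x₀)) (tl x₀))
     else cons (hd (hd x₀)) (call withoutᶠ (cons (tl (hd x₀)) (tl x₀))))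
  else nil

-- es ∙ D
edgesᵇ =
  if hd x₀ then
    (if call memberᶠ (cons (hd (hd (hd x₀))) (tl x₀)) then call edgesᶠ (cons (tl (hd x₀)) (tl x₀))
     else (if call memberᶠ (cons (tl (hd (hd x₀))) (tl x₀)) then call edgesᶠ (cons (tl (hd x₀)) (tl x₀))
     else cons (hd (hd x₀)) (call edgesᶠ (cons (tl (hd x₀)) (tl x₀)))))
  else nil

-- a ∙ (v ∙ E)
endᵇ =
  if hd x₀ then
    (if call memberᶠ (cons (cons (hd (tl x₀)) (hd (hd x₀))) (tl (tl x₀))) then true′
     else call memberᶠ (cons (cons (hd (hd x₀)) (hd (tl x₀))) (tl (tl x₀))))
  else true′

-- S
endsᵇ =
  if x₀ then cons (cons (hd x₀) nil) (call endsᶠ (tl x₀)) else cons nil nil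

-- a ∙ (bs ∙ rest)
rowᵇ =
  if hd (tl x₀) then
    cons (cons (cons (hd x₀) (hd (hd (tl x₀)))) (cons nil nil))
         (call rowᶠ (cons (hd x₀) (cons (tl (hd (tl x₀))) (tl (tl x₀)))))
  -- The rows already built serve as an accumulator, which replaces concatenation.
  else tl (tl x₀)

-- as ∙ bs
tableᵇ =
  if hd x₀ then
    call rowᶠ (cons (hd (hd x₀)) (cons (tl x₀) (call tableᶠ (cons (tl (hd x₀)) (tl x₀)))))
  else nil

-- (w ∙ ℓ) ∙ (es ∙ E)
matchᵇ =
  if call equalᶠ (cons (hd (tl (hd (hd (tl x₀))))) (tl (hd x₀))) then
    (if call endᶠ (cons (hd (hd (hd (hd (tl x₀))))) (cons (hd (hd x₀)) (tl (tl x₀))))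
     then call endᶠ (cons (tl (hd (hd (hd (tl x₀))))) (cons (hd (hd x₀)) (tl (tl x₀))))
     else nil)
  else nil

claimᵇ =
  if hd (tl x₀) then
    (if matchᵇ then
       cons (tl (tl (hd (hd (tl x₀)))))
            (cons (cons (hd (hd (hd (tl x₀)))) (cons (cons nil (tl (hd x₀))) (cons (hd (hd x₀)) nil)))
                  (tl (hd (tl x₀))))
     else
       let′ (call claimᶠ (cons (hd x₀) (cons (tl (hd (tl x₀))) (tl (tl x₀)))))
         -- Failure is `nil` and success is a pair, so evicting nobody is still told apart from
         -- finding no slot.
         (if x₀ then cons (hd x₀) (cons (hd (hd (tl x₁))) (tl x₀)) else nil))
  else nil

-- queue ∙ ((ℓ ∙ zs) ∙ (es ∙ (E ∙ D)))
auctionᵇ =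
  if hd x₀ then
    let′ (call claimᶠ (cons (cons (hd (hd x₀)) (hd (hd (tl x₀))))
                            (cons (hd (tl (tl x₀))) (hd (tl (tl (tl x₀)))))))
      (if x₀ then
         (if hd x₀ then
            call auctionᶠ (cons (cons (hd (hd x₀)) (tl (hd x₁))) restart)
          else
            call auctionᶠ (cons (tl (hd x₁)) restart))
       else
         (if tl (hd (tl x₁)) then
            call auctionᶠ (cons (hd x₁) (cons (cons (cons nil (hd (hd (tl x₁)))) (tl (tl (hd (tl x₁)))))
                                              (tl (tl x₁))))
          else
            call auctionᶠ (cons (tl (hd x₁)) (cons (cons nil (hd (tl (tl x₁))))
              (cons (hd (tl (tl x₁))) (cons (hd (tl (tl (tl x₁)))) (cons (hd (hd x₁)) (tl (tl (tl (tl x₁)))))))))))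
  else tl (tl (tl (tl x₀)))
  where
  restart : Exp 11 2
  -- Level 0, with the updated table both as the fresh counter and as the current state.
  restart = cons (cons nil (tl x₀)) (cons (tl x₀) (tl (tl (tl x₁))))

-- ((V ∙ E) ∙ B) ∙ S
mainᵇ =
  let′ (call withoutᶠ (cons (call withoutᶠ (cons (hd (hd (hd x₀))) (tl x₀))) (tl (hd x₀))))
  (let′ (call endsᶠ (tl x₁))
  (let′ (call tableᶠ (cons x₀ x₀))
  (let′ (call auctionᶠ (cons x₂ (cons (cons nil x₀) (cons x₀ (cons (tl (hd (hd x₃))) nil)))))
    (cons (cons (cons (call withoutᶠ (cons (hd (hd (hd x₄))) x₀))
                      (call edgesᶠ (cons (tl (hd (hd x₄))) x₀)))
                (tl (hd x₄)))
          -- The cover is passed through, and `cons nil nil` encodes the offset 0.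
          (cons (tl x₄) (cons nil nil))))))
  where
  x₄ : Exp 11 5
  x₄ = var (suc (suc (suc (suc zero))))

F : Vec (Exp 11 1) 11
F = mainᵇ ∷ equalᵇ ∷ memberᵇ ∷ withoutᵇ ∷ edgesᵇ ∷ endᵇ ∷ endsᵇ ∷ rowᵇ ∷ tableᵇ ∷ claimᵇ ∷ auctionᵇ ∷ []

open Cost F

-- Correctness and running time of its functions

infix 4 _≟ᴰ_

_≟ᴰ_ : DecidableEquality Data
nil     ≟ᴰ nil     = yes refl
nil     ≟ᴰ (_ ∙ _) = no λ ()
(_ ∙ _) ≟ᴰ nil     = no λ ()
(a ∙ b) ≟ᴰ (c ∙ d) = map′ (λ { (refl , refl) → refl }) (λ { refl → refl , refl }) (a ≟ᴰ c ×-dec b ≟ᴰ d)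

module _ {n} {ρ : Vec Data n} {e : Exp 11 n} {v : Data} where

  -- Charges `c` to each tree node. The separate `c′` admits a cheaper left part, such as an
  -- equality test within a membership test.
  node : ∀ c c′ m n {k} {k≤c : IsTrue (k ≤ᵇ c)} {c′≤c : IsTrue (c′ ≤ᵇ c)} →
         Evaluates ρ e v k (c′ * m + c * n) → Evaluates ρ e v 0 (c * suc (m + n))
  node c c′ m n {k} {k≤c} {c′≤c} = within (begin
    k + (c′ * m + c * n)   ≤⟨ +-mono-≤ (≤ᵇ⇒≤ k c k≤c) (+-monoˡ-≤ (c * n) (*-monoˡ-≤ m (≤ᵇ⇒≤ c′ c c′≤c))) ⟩
    c + (c * m + c * n)    ≡⟨ cong (c +_) (*-distribˡ-+ c m n) ⟨
    c + c * (m + n)        ≡⟨ *-suc c (m + n) ⟨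
    c * suc (m + n)        ∎)

  leaf : ∀ c d {k} {k≤c : IsTrue (k ≤ᵇ c)} → Evaluates ρ e v k 0 → Evaluates ρ e v 0 (c * ∥ d ∥)
  leaf c d {k} {k≤c} = within (begin
    k + 0       ≡⟨ +-identityʳ k ⟩
    k           ≤⟨ ≤ᵇ⇒≤ k c k≤c ⟩
    c           ≡⟨ *-identityʳ c ⟨
    c * 1       ≤⟨ *-monoʳ-≤ c (1≤∥ d ∥) ⟩
    c * ∥ d ∥   ∎)
    where
    1≤∥_∥ : ∀ d → 1 ≤ ∥ d ∥
    1≤∥ nil ∥   = s≤s z≤n
    1≤∥ _ ∙ _ ∥ = s≤s z≤n

  -- Charges `c + C` to each round of a list recursion: `c` for the overhead, `C` for the calls
  -- made. The numerals chosen for `c` are generous; they only have to exceed the counted steps.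
  loop : ∀ c C n {k} {k≤c : IsTrue (k ≤ᵇ c)} →
         Evaluates ρ e v k (C + n * (c + C)) → Evaluates ρ e v 0 (suc n * (c + C))
  loop c C n {k} {k≤c} = within (begin
    k + (C + n * (c + C))   ≤⟨ +-monoˡ-≤ (C + n * (c + C)) (≤ᵇ⇒≤ k c k≤c) ⟩
    c + (C + n * (c + C))   ≡⟨ +-assoc c C (n * (c + C)) ⟨
    suc n * (c + C)         ∎)

-- Both trees are descended in step, so the second alone bounds the time. Callers put the argument
-- of controlled size second: a list entry, or the current level.
equal↓ : ∀ a b → Calls equalᶠ (a ∙ b) (encodeBool (does (a ≟ᴰ b))) (30 * ∥ b ∥)
equal↓ nil     nil       = leaf 30 nil (false↓ basic↓ (false↓ basic↓ basic↓))
equal↓ nil     d@(_ ∙ _) = leaf 30 d (false↓ basic↓ (true↓ basic↓ basic↓))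
equal↓ (_ ∙ _) nil       = leaf 30 nil (true↓ basic↓ (false↓ basic↓ basic↓))
equal↓ (a ∙ b) (c ∙ d) with does (a ≟ᴰ c) | equal↓ a c
... | true  | eq = node 30 30 ∥ c ∥ ∥ d ∥
                     (true↓ basic↓ (true↓ basic↓ (true↓ (call↓ basic↓ eq) (call↓ basic↓ (equal↓ b d)))))
... | false | eq = node 30 30 ∥ c ∥ ∥ d ∥
                     (weaken {k′ = 30} (+-monoʳ-≤ (30 * ∥ c ∥) z≤n)
                       (true↓ basic↓ (true↓ basic↓ (false↓ (call↓ basic↓ eq) basic↓))))

module _ {A : Set} (enc : A → Data) (enc-injective : ∀ {x y} → enc x ≡ enc y → x ≡ y)
         (_≟_ : DecidableEquality A) where

  open DecMembership _≟_ using () renaming (_∈?_ to _∈ᴬ?_)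

  equal-enc↓ : ∀ x y → Calls equalᶠ (enc x ∙ enc y) (encodeBool (does (x ≟ y))) (30 * ∥ enc y ∥)
  equal-enc↓ x y = subst (λ b → Calls equalᶠ _ (encodeBool b) _)
    (does-⇔ (mk⇔ enc-injective (cong enc)) (enc x ≟ᴰ enc y) (x ≟ y)) (equal↓ (enc x) (enc y))

  member↓ : ∀ x xs → Calls memberᶠ (enc x ∙ encodeList enc xs) (encodeBool (does (x ∈ᴬ? xs)))
                       (40 * ∥ encodeList enc xs ∥)
  member↓ x [] = leaf 40 nil (false↓ basic↓ basic↓)
  member↓ x (y ∷ xs) with does (x ≟ y) | equal-enc↓ x y
  ... | true  | eq = node 40 30 ∥ enc y ∥ ∥ encodeList enc xs ∥
                       (weaken {k′ = 40} (+-monoʳ-≤ (30 * ∥ enc y ∥) z≤n)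
                         (true↓ basic↓ (true↓ (call↓ basic↓ eq) basic↓)))
  ... | false | eq = node 40 30 ∥ enc y ∥ ∥ encodeList enc xs ∥
                       (true↓ basic↓ (false↓ (call↓ basic↓ eq) (call↓ basic↓ (member↓ x xs))))

encodeList-injective : {A : Set} (enc : A → Data) → (∀ {x y} → enc x ≡ enc y → x ≡ y) →
                       ∀ {xs ys} → encodeList enc xs ≡ encodeList enc ys → xs ≡ ys
encodeList-injective enc inj {[]}     {[]}     _  = refl
encodeList-injective enc inj {x ∷ xs} {y ∷ ys} eq =
  cong₂ _∷_ (inj (cong head eq)) (encodeList-injective enc inj (cong tail eq))

encodeName-injective : ∀ {x y} → encodeName x ≡ encodeName y → x ≡ y
encodeName-injective = encodeList-injective encodeBool encodeBool-injective
  where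
  encodeBool-injective : ∀ {x y} → encodeBool x ≡ encodeBool y → x ≡ y
  encodeBool-injective {false} {false} _ = refl
  encodeBool-injective {true}  {true}  _ = refl

encodeEdge : Name × Name → Data
encodeEdge (u , v) = encodeName u ∙ encodeName v

encodeEdge-injective : ∀ {x y} → encodeEdge x ≡ encodeEdge y → x ≡ y
encodeEdge-injective eq =
  cong₂ _,_ (encodeName-injective (cong head eq)) (encodeName-injective (cong tail eq))

Names : List Name → Data
Names = encodeList encodeName

Edges : List (Name × Name) → Data
Edges = encodeList encodeEdge

memberName↓ : ∀ v D → Calls memberᶠ (encodeName v ∙ Names D) (encodeBool (does (v ∈? D))) (40 * ∥ Names D ∥)
memberName↓ = member↓ encodeName encodeName-injective _≟ᴺ_

memberEdge↓ : ∀ e es → Calls memberᶠ (encodeEdge e ∙ Edges es)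
                (encodeBool (does (e EdgeMembership.∈? es))) (40 * ∥ Edges es ∥)
memberEdge↓ = member↓ encodeEdge encodeEdge-injective _

without↓ : ∀ xs D → Calls withoutᶠ (Names xs ∙ Names D) (Names (without xs D))
             (suc (length xs) * (50 + 40 * ∥ Names D ∥))
without↓ [] D = loop 50 (40 * ∥ Names D ∥) 0 (weaken {k′ = 50} z≤n (false↓ basic↓ basic↓))
without↓ (x ∷ xs) D with does (x ∈? D) | memberName↓ x D
... | true  | mem = loop 50 (40 * ∥ Names D ∥) (suc (length xs))
                      (true↓ basic↓ (true↓ (call↓ basic↓ mem) (call↓ basic↓ (without↓ xs D))))
... | false | mem = loop 50 (40 * ∥ Names D ∥) (suc (length xs))
                      (true↓ basic↓ (false↓ (call↓ basic↓ mem) (cons↓ basic↓ (call↓ basic↓ (without↓ xs D)))))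

edges↓ : ∀ G D → Calls edgesᶠ (Edges (E G) ∙ Names D) (Edges (E (G − D)))
           (suc (length (E G)) * (90 + (40 * ∥ Names D ∥ + 40 * ∥ Names D ∥)))
edges↓ G D = go (E G)
  where
  C = 40 * ∥ Names D ∥
  go : ∀ es → Calls edgesᶠ (Edges es ∙ Names D)
         (Edges (filter (λ e → ¬? (proj₁ e ∈? D) ×-dec ¬? (proj₂ e ∈? D)) es))
         (suc (length es) * (90 + (C + C)))
  go [] = loop 90 (C + C) 0 (weaken {k′ = 90} z≤n (false↓ basic↓ basic↓))
  go ((u , v) ∷ es) with does (u ∈? D) | memberName↓ u D
  ... | true | mem = loop 90 (C + C) (suc (length es))
        (weaken {k′ = 90} (+-monoˡ-≤ (suc (length es) * (90 + (C + C))) (m≤m+n C C))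
          (true↓ basic↓ (true↓ (call↓ basic↓ mem) (call↓ basic↓ (go es)))))
  ... | false | mem with does (v ∈? D) | memberName↓ v D
  ...   | true | mem′ = loop 90 (C + C) (suc (length es))
          (weaken {k′ = 90} (≤-reflexive (sym (+-assoc C C (suc (length es) * (90 + (C + C))))))
            (true↓ basic↓ (false↓ (call↓ basic↓ mem) (true↓ (call↓ basic↓ mem′) (call↓ basic↓ (go es))))))
  ...   | false | mem′ = loop 90 (C + C) (suc (length es))
          (weaken {k′ = 90} (≤-reflexive (sym (+-assoc C C (suc (length es) * (90 + (C + C))))))
            (true↓ basic↓ (false↓ (call↓ basic↓ mem) (false↓ (call↓ basic↓ mem′)
              (cons↓ basic↓ (call↓ basic↓ (go es)))))))

m+0≤m+n : ∀ m n → m + 0 ≤ m + n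
m+0≤m+n m n = +-monoʳ-≤ m z≤n

absorb : ∀ {n} {ρ : Vec Data n} {e v} c C {k T} {k≤c : IsTrue (k ≤ᵇ c)} → T ≤ C →
         Evaluates ρ e v k T → Evaluates ρ e v 0 (c + C)
absorb c C {k} {k≤c = k≤c} T≤C = within (+-mono-≤ (≤ᵇ⇒≤ k c k≤c) T≤C)

encodeMaybe : Maybe Name → Data
encodeMaybe nothing  = nil
encodeMaybe (just v) = encodeName v ∙ nil

-- Raising a label is then a single `cons`, and labels exceed the number of slots by at most one, so
-- unary notation stays polynomial.
encodeUnary : ℕ → Data
encodeUnary zero    = nil
encodeUnary (suc n) = nil ∙ encodeUnary n

encodeEntry : Entry Slot Name → Data
encodeEntry (entry (a , b) ℓ o) = (encodeMaybe a ∙ encodeMaybe b) ∙ (encodeUnary ℓ ∙ encodeMaybe o)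

Ends : List (Maybe Name) → Data
Ends = encodeList encodeMaybe

Table : List (Entry Slot Name) → Data
Table = encodeList encodeEntry

initial : Slot → Entry Slot Name
initial k = entry k 0 nothing

ends↓ : ∀ S → Calls endsᶠ (Names S) (Ends (ends S)) (suc (length S) * (30 + 0))
ends↓ []      = loop 30 0 0 (weaken {k′ = 30} z≤n (false↓ basic↓ basic↓))
ends↓ (s ∷ S) = loop 30 0 (suc (length S)) (true↓ basic↓ (cons↓ basic↓ (call↓ basic↓ (ends↓ S))))

row↓ : ∀ a bs es → Calls rowᶠ (encodeMaybe a ∙ (Ends bs ∙ Table es))
         (Table (map initial (map (a ,_) bs) ++ es)) (suc (length bs) * (40 + 0))
row↓ a [] es       = loop 40 0 0 (weaken {k′ = 40} z≤n (false↓ basic↓ basic↓))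
row↓ a (b ∷ bs) es = loop 40 0 (suc (length bs)) (true↓ basic↓ (cons↓ basic↓ (call↓ basic↓ (row↓ a bs es))))

table↓ : ∀ as bs → Calls tableᶠ (Ends as ∙ Ends bs) (Table (map initial (cartesianProduct as bs)))
           (suc (length as) * (40 + suc (length bs) * (40 + 0)))
table↓ [] bs = loop 40 (suc (length bs) * (40 + 0)) 0 (weaken {k′ = 40} z≤n (false↓ basic↓ basic↓))
table↓ (a ∷ as) bs =
    (loop 40 (suc (length bs) * (40 + 0)) (suc (length as))
      (weaken {k′ = 40} (≤-reflexive (+-comm (suc (length as) * (40 + suc (length bs) * (40 + 0))) _))
        (true↓ basic↓ (call↓ (cons↓ basic↓ (cons↓ basic↓ (call↓ basic↓ (table↓ as bs)))) row))))
  where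
  table : List (Entry Slot Name)
  table = map initial (cartesianProduct as bs)
  row : Calls rowᶠ (encodeMaybe a ∙ (Ends bs ∙ Table table)) (Table (map initial (cartesianProduct (a ∷ as) bs)))
          (suc (length bs) * (40 + 0))
  row = subst (λ es → Calls rowᶠ (encodeMaybe a ∙ (Ends bs ∙ Table table)) (Table es) (suc (length bs) * (40 + 0)))
          (sym (map-++ initial (map (a ,_) bs) (cartesianProduct as bs))) (row↓ a bs table)

encodeUnary-injective : ∀ {m n} → encodeUnary m ≡ encodeUnary n → m ≡ n
encodeUnary-injective {zero}  {zero}  _  = refl
encodeUnary-injective {suc m} {suc n} eq = cong suc (encodeUnary-injective (cong tail eq))

∥encodeUnary∥ : ∀ n → ∥ encodeUnary n ∥ ≡ suc (n * 2)
∥encodeUnary∥ zero    = refl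
∥encodeUnary∥ (suc n) = cong (2 +_) (∥encodeUnary∥ n)

∥encodeUnary∥-mono : ∀ {m n} → m ≤ n → ∥ encodeUnary m ∥ ≤ ∥ encodeUnary n ∥
∥encodeUnary∥-mono {m} {n} m≤n = begin
  ∥ encodeUnary m ∥   ≡⟨ ∥encodeUnary∥ m ⟩
  suc (m * 2)         ≤⟨ s≤s (*-monoˡ-≤ 2 m≤n) ⟩
  suc (n * 2)         ≡⟨ ∥encodeUnary∥ n ⟨
  ∥ encodeUnary n ∥   ∎

-- Running time of claims and of the auction

module _ (G : Graph) where

  open Auction (SlotAdj G)

  memberCost endCost : ℕ
  memberCost = 40 * ∥ Edges (E G) ∥
  endCost    = 40 + (memberCost + memberCost)

  end↓ : ∀ a v → Calls endᶠ (encodeMaybe a ∙ (encodeName v ∙ Edges (E G))) (encodeBool (does (endAdj? G a v))) endCost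
  end↓ nothing v = absorb 40 (memberCost + memberCost) z≤n (false↓ basic↓ basic↓)
  end↓ (just a) v with does ((v , a) EdgeMembership.∈? E G) | memberEdge↓ (v , a) (E G)
  ... | true  | mem = absorb 40 (memberCost + memberCost) (m+0≤m+n memberCost memberCost)
                        (true↓ basic↓ (true↓ (call↓ basic↓ mem) basic↓))
  ... | false | mem = absorb 40 (memberCost + memberCost) ≤-refl
                        (true↓ basic↓ (false↓ (call↓ basic↓ mem) (call↓ basic↓ (memberEdge↓ (a , v) (E G)))))

  match? : ∀ w ℓ e → Dec (Match w ℓ e)
  match? w ℓ e = (label e ℕₚ.≟ ℓ) ×-dec slotAdj? G (key e) w

  matchCost : ℕ → ℕ
  matchCost ℓ = 30 * ∥ encodeUnary ℓ ∥ + (endCost + endCost)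

  module _ (w : Name) (ℓ : ℕ) (e : Entry Slot Name) (es : List (Entry Slot Name)) where

    claimArg : Data
    claimArg = (encodeName w ∙ encodeUnary ℓ) ∙ (Table (e ∷ es) ∙ Edges (E G))

    match↓ : Evaluates (claimArg ∷ []) matchᵇ (encodeBool (does (match? w ℓ e))) 100 (matchCost ℓ)
    match↓ with does (label e ℕₚ.≟ ℓ) | equal-enc↓ encodeUnary encodeUnary-injective ℕₚ._≟_ (label e) ℓ
    ... | false | eq = weaken (m+0≤m+n (30 * ∥ encodeUnary ℓ ∥) (endCost + endCost)) (false↓ (call↓ basic↓ eq) basic↓)
    ... | true  | eq with does (endAdj? G (proj₁ (key e)) w) | end↓ (proj₁ (key e)) w
    ...   | false | end = weaken (+-monoʳ-≤ (30 * ∥ encodeUnary ℓ ∥) (m+0≤m+n endCost endCost))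
                            (true↓ (call↓ basic↓ eq) (false↓ (call↓ basic↓ end) basic↓))
    ...   | true  | end = weaken ≤-refl
                            (true↓ (call↓ basic↓ eq) (true↓ (call↓ basic↓ end) (call↓ basic↓ (end↓ (proj₂ (key e)) w))))

    match↓-true : Match w ℓ e → Evaluates (claimArg ∷ []) matchᵇ (encodeBool true) 100 (matchCost ℓ)
    match↓-true match = subst (λ b → Evaluates (claimArg ∷ []) matchᵇ (encodeBool b) 100 (matchCost ℓ)) (dec-true (match? w ℓ e) match) match↓

    match↓-false : ¬ Match w ℓ e → Evaluates (claimArg ∷ []) matchᵇ (encodeBool false) 100 (matchCost ℓ)
    match↓-false ¬match = subst (λ b → Evaluates (claimArg ∷ []) matchᵇ (encodeBool b) 100 (matchCost ℓ)) (dec-false (match? w ℓ e) ¬match) match↓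

  claimCost : ℕ → ℕ → ℕ
  claimCost ℓ n = suc n * (200 + matchCost ℓ)

  claim↓ : ∀ {w ℓ es o es′} → Claim w ℓ es o es′ →
           Calls claimᶠ ((encodeName w ∙ encodeUnary ℓ) ∙ (Table es ∙ Edges (E G)))
             (encodeMaybe o ∙ Table es′) (claimCost ℓ (length es))
  claim↓ {w} {ℓ} (here {k} {o} {es} k~w) = loop 200 (matchCost ℓ) (suc (length es))
    (weaken {k′ = 200} (m+0≤m+n (matchCost ℓ) (suc (length es) * (200 + matchCost ℓ)))
      (true↓ basic↓ (true↓ (match↓-true w ℓ (entry k ℓ o) es (refl , k~w)) basic↓)))
  claim↓ {w} {ℓ} (there {e} {o} {es} ¬match claim) = loop 200 (matchCost ℓ) (suc (length es))
    (weaken {k′ = 200} (+-monoʳ-≤ (matchCost ℓ) (≤-reflexive (+-identityʳ _)))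
      (true↓ basic↓ (false↓ (match↓-false w ℓ e es ¬match)
        (let↓ (call↓ basic↓ (claim↓ claim)) (true↓ basic↓ basic↓)))))

  ¬claim↓ : ∀ {w ℓ es} → All (λ e → ¬ Match w ℓ e) es →
            Calls claimᶠ ((encodeName w ∙ encodeUnary ℓ) ∙ (Table es ∙ Edges (E G))) nil (claimCost ℓ (length es))
  ¬claim↓ {w} {ℓ} [] = loop 200 (matchCost ℓ) 0 (weaken {k′ = 200} z≤n (false↓ basic↓ basic↓))
  ¬claim↓ {w} {ℓ} {e ∷ es} (¬match ∷ ¬matches) = loop 200 (matchCost ℓ) (suc (length es))
    (weaken {k′ = 200} (+-monoʳ-≤ (matchCost ℓ) (≤-reflexive (+-identityʳ _)))
      (true↓ basic↓ (false↓ (match↓-false w ℓ e es ¬match)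
        (let↓ (call↓ basic↓ (¬claim↓ ¬matches)) (false↓ basic↓ basic↓)))))

  claimCost-mono : ∀ {ℓ m n} → ℓ ≤ n → m ≡ n → claimCost ℓ m ≤ claimCost n n
  claimCost-mono {n = n} ℓ≤n refl =
    *-monoʳ-≤ (suc n) (+-monoʳ-≤ 200 (+-monoˡ-≤ (endCost + endCost) (*-monoʳ-≤ 30 (∥encodeUnary∥-mono ℓ≤n))))

  auctionArg : List Name → ℕ → List (Entry Slot Name) → List (Entry Slot Name) → List Name → Data
  auctionArg q ℓ zs es D = Names q ∙ ((encodeUnary ℓ ∙ Table zs) ∙ (Table es ∙ (Edges (E G) ∙ Names D)))

  claim-length : ∀ {w ℓ es o es′} → Claim w ℓ es o es′ → length es′ ≡ length es
  claim-length {es = es} {es′ = es′} claim =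
    trans (sym (length-map key es′)) (trans (cong length (claim-keys claim)) (length-map key es))

  -- Every round makes one scan of the table. The invariant `ℓ + length zs ≡ n` keeps the level at
  -- most `n`, so `claimCost n n` bounds each scan.
  auction↓ : ∀ {n c q ℓ zs es D es∞ D∞} → Run c q ℓ zs es D es∞ D∞ → length es ≡ n → ℓ + length zs ≡ n →
             Calls auctionᶠ (auctionArg q ℓ zs es D) (Names D∞) (suc c * (200 + claimCost n n))
  auction↓ {n} done _ _ = loop 200 (claimCost n n) 0 (weaken {k′ = 200} z≤n (false↓ basic↓ basic↓))
  auction↓ {n} {suc c} {ℓ = ℓ} (claimed {o = just v} claim run) size level = loop 200 (claimCost n n) (suc c)
    (weaken {k′ = 200} (+-monoˡ-≤ (suc c * (200 + claimCost n n)) (claimCost-mono (m+n≤o⇒m≤o ℓ (≤-reflexive level)) size))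
      (true↓ basic↓ (let↓ (call↓ basic↓ (claim↓ claim)) (true↓ basic↓ (true↓ basic↓
        (call↓ basic↓ (auction↓ run size′ size′)))))))
    where size′ = trans (claim-length claim) size
  auction↓ {n} {suc c} {ℓ = ℓ} (claimed {o = nothing} claim run) size level = loop 200 (claimCost n n) (suc c)
    (weaken {k′ = 200} (+-monoˡ-≤ (suc c * (200 + claimCost n n)) (claimCost-mono (m+n≤o⇒m≤o ℓ (≤-reflexive level)) size))
      (true↓ basic↓ (let↓ (call↓ basic↓ (claim↓ claim)) (true↓ basic↓ (false↓ basic↓
        (call↓ basic↓ (auction↓ run size′ size′)))))))
    where size′ = trans (claim-length claim) size
  auction↓ {n} {suc c} {ℓ = ℓ} (climb {zs = zs} ¬matches run) size level = loop 200 (claimCost n n) (suc c)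
    (weaken {k′ = 200} (+-monoˡ-≤ (suc c * (200 + claimCost n n)) (claimCost-mono (m+n≤o⇒m≤o ℓ (≤-reflexive level)) size))
      (true↓ basic↓ (let↓ (call↓ basic↓ (¬claim↓ ¬matches)) (false↓ basic↓ (true↓ basic↓
        (call↓ basic↓ (auction↓ run size (trans (sym (+-suc ℓ (length zs))) level))))))))
  auction↓ {n} {suc c} {ℓ = ℓ} (discard ¬matches run) size level = loop 200 (claimCost n n) (suc c)
    (weaken {k′ = 200} (+-monoˡ-≤ (suc c * (200 + claimCost n n)) (claimCost-mono (m+n≤o⇒m≤o ℓ (≤-reflexive level)) size))
      (true↓ basic↓ (let↓ (call↓ basic↓ (¬claim↓ ¬matches)) (false↓ basic↓ (false↓ basic↓
        (call↓ basic↓ (auction↓ run size size)))))))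

-- Polynomial bounds

infixl 6 _:+_
infixl 7 _:*_

-- With polynomials as syntax, polynomial growth is proved once by induction, and a concrete bound
-- can be inferred from the way its proof is composed.
data Poly : Set where
  X         : Poly
  con       : ℕ → Poly
  _:+_ _:*_ : Poly → Poly → Poly

⟦_⟧ : Poly → ℕ → ℕ
⟦ X ⟧      n = n
⟦ con c ⟧  n = c
⟦ p :+ q ⟧ n = ⟦ p ⟧ n + ⟦ q ⟧ n
⟦ p :* q ⟧ n = ⟦ p ⟧ n * ⟦ q ⟧ n

*-exchange : ∀ a b c d → (a * b) * (c * d) ≡ (a * c) * (b * d)
*-exchange = solve-∀

-- Powers of `suc n` grow with the exponent even at `n = 0`, so this form of bound is closed under
-- sums and products.
monomial-bound : ∀ p → ∃[ c ] ∃[ d ] ∀ n → ⟦ p ⟧ n ≤ c * suc n ^ d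
monomial-bound X = 1 , 1 , λ n → begin
  n                 ≤⟨ n≤1+n n ⟩
  suc n             ≡⟨ ^-identityʳ (suc n) ⟨
  suc n ^ 1         ≡⟨ *-identityˡ (suc n ^ 1) ⟨
  1 * suc n ^ 1     ∎
monomial-bound (con c) = c , 0 , λ n → ≤-reflexive (sym (*-identityʳ c))
monomial-bound (p :+ q) with c , d , p≤ ← monomial-bound p | c′ , d′ , q≤ ← monomial-bound q =
  c + c′ , d + d′ , λ n → begin
    ⟦ p ⟧ n + ⟦ q ⟧ n                               ≤⟨ +-mono-≤ (p≤ n) (q≤ n) ⟩
    c * suc n ^ d + c′ * suc n ^ d′                 ≤⟨ +-mono-≤ (*-monoʳ-≤ c (^-monoʳ-≤ (suc n) (m≤m+n d d′)))
                                                                (*-monoʳ-≤ c′ (^-monoʳ-≤ (suc n) (m≤n+m d′ d))) ⟩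
    c * suc n ^ (d + d′) + c′ * suc n ^ (d + d′)    ≡⟨ *-distribʳ-+ (suc n ^ (d + d′)) c c′ ⟨
    (c + c′) * suc n ^ (d + d′)                     ∎
monomial-bound (p :* q) with c , d , p≤ ← monomial-bound p | c′ , d′ , q≤ ← monomial-bound q =
  c * c′ , d + d′ , λ n → begin
    ⟦ p ⟧ n * ⟦ q ⟧ n                        ≤⟨ *-mono-≤ (p≤ n) (q≤ n) ⟩
    (c * suc n ^ d) * (c′ * suc n ^ d′)      ≡⟨ *-exchange c (suc n ^ d) c′ (suc n ^ d′) ⟩
    (c * c′) * (suc n ^ d * suc n ^ d′)      ≡⟨ cong (c * c′ *_) (^-distribˡ-+-* (suc n) d d′) ⟨
    (c * c′) * suc n ^ (d + d′)              ∎

^-distribʳ-* : ∀ d m n → (m * n) ^ d ≡ m ^ d * n ^ d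
^-distribʳ-* zero    m n = refl
^-distribʳ-* (suc d) m n = trans (cong (m * n *_) (^-distribʳ-* d m n)) (*-exchange m n (m ^ d) (n ^ d))

-- For positive `n`, `suc n` is at most `2 * n`; the additive `2 ^ d` takes care of `n = 0`.
suc-^-bound : ∀ n d → suc n ^ d ≤ 2 ^ d * n ^ d + 2 ^ d
suc-^-bound zero d = begin
  1 ^ d                     ≡⟨ ^-zeroˡ d ⟩
  1                         ≤⟨ m^n>0 2 d ⟩
  2 ^ d                     ≤⟨ m≤n+m (2 ^ d) (2 ^ d * 0 ^ d) ⟩
  2 ^ d * 0 ^ d + 2 ^ d     ∎
suc-^-bound n@(suc _) d = begin
  suc n ^ d                 ≤⟨ ^-monoˡ-≤ d (+-mono-≤ {1} {n} (s≤s z≤n) (m≤m+n n 0)) ⟩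
  (2 * n) ^ d               ≡⟨ ^-distribʳ-* d 2 n ⟩
  2 ^ d * n ^ d             ≤⟨ m≤m+n (2 ^ d * n ^ d) (2 ^ d) ⟩
  2 ^ d * n ^ d + 2 ^ d     ∎

polynomial : ∀ p → PolynomiallyBounded ⟦ p ⟧
polynomial p with c , d , p≤ ← monomial-bound p = c * 2 ^ d , d , λ n → begin
  ⟦ p ⟧ n                               ≤⟨ p≤ n ⟩
  c * suc n ^ d                         ≤⟨ *-monoʳ-≤ c (suc-^-bound n d) ⟩
  c * (2 ^ d * n ^ d + 2 ^ d)           ≡⟨ *-distribˡ-+ c (2 ^ d * n ^ d) (2 ^ d) ⟩
  c * (2 ^ d * n ^ d) + c * 2 ^ d       ≡⟨ cong (_+ c * 2 ^ d) (*-assoc c (2 ^ d) (n ^ d)) ⟨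
  c * 2 ^ d * n ^ d + c * 2 ^ d         ∎

-- Wrapping the inequality in a record keeps `p` visible to unification, which could not recover it
-- from the unfolded `⟦ p ⟧ n`.
record _≤⟦_⟧_ (m : ℕ) (p : Poly) (n : ℕ) : Set where
  constructor bounded
  field bound : m ≤ ⟦ p ⟧ n

open _≤⟦_⟧_

module _ {n : ℕ} where

  infixl 6 _⟨+⟩_
  infixl 7 _⟨*⟩_

  var≤ : ∀ {m} → m ≤ n → m ≤⟦ X ⟧ n
  var≤ = bounded

  con≤ : ∀ c → c ≤⟦ con c ⟧ n
  con≤ c = bounded ≤-refl

  _⟨+⟩_ : ∀ {m₁ m₂ p₁ p₂} → m₁ ≤⟦ p₁ ⟧ n → m₂ ≤⟦ p₂ ⟧ n → (m₁ + m₂) ≤⟦ p₁ :+ p₂ ⟧ n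
  bounded ≤₁ ⟨+⟩ bounded ≤₂ = bounded (+-mono-≤ ≤₁ ≤₂)

  _⟨*⟩_ : ∀ {m₁ m₂ p₁ p₂} → m₁ ≤⟦ p₁ ⟧ n → m₂ ≤⟦ p₂ ⟧ n → (m₁ * m₂) ≤⟦ p₁ :* p₂ ⟧ n
  bounded ≤₁ ⟨*⟩ bounded ≤₂ = bounded (*-mono-≤ ≤₁ ≤₂)

  suc≤ : ∀ {m p} → m ≤⟦ p ⟧ n → suc m ≤⟦ con 1 :+ p ⟧ n
  suc≤ (bounded m≤) = bounded (s≤s m≤)

  ≤-via : ∀ {m m′ p} → m ≤ m′ → m′ ≤⟦ p ⟧ n → m ≤⟦ p ⟧ n
  ≤-via m≤ (bounded m′≤) = bounded (≤-trans m≤ m′≤)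

-- Sizes of encodings

∥encodeList∥≤ : ∀ {A : Set} (enc : A → Data) xs {b} → All (λ x → ∥ enc x ∥ ≤ b) xs →
                ∥ encodeList enc xs ∥ ≤ suc (length xs * suc b)
∥encodeList∥≤ enc []       []         = ≤-refl
∥encodeList∥≤ enc (x ∷ xs) {b} (x≤ ∷ xs≤) = s≤s (begin
  ∥ enc x ∥ + ∥ encodeList enc xs ∥   ≤⟨ +-mono-≤ x≤ (∥encodeList∥≤ enc xs xs≤) ⟩
  b + suc (length xs * suc b)         ≡⟨ +-suc b (length xs * suc b) ⟩
  suc (b + length xs * suc b)         ∎)

length≤∥encodeList∥ : ∀ {A : Set} (enc : A → Data) xs → length xs ≤ ∥ encodeList enc xs ∥
length≤∥encodeList∥ enc []       = z≤n
length≤∥encodeList∥ enc (x ∷ xs) = s≤s (m≤n⇒m≤o+n ∥ enc x ∥ (length≤∥encodeList∥ enc xs))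

∈⇒∥∥≤ : ∀ {A : Set} (enc : A → Data) {x xs} → x ∈ xs → ∥ enc x ∥ ≤ ∥ encodeList enc xs ∥
∈⇒∥∥≤ enc {xs = x ∷ xs} (here refl) = m≤n⇒m≤1+n (m≤m+n ∥ enc x ∥ ∥ encodeList enc xs ∥)
∈⇒∥∥≤ enc {xs = y ∷ xs} (there x∈)  = m≤n⇒m≤1+n (m≤n⇒m≤o+n ∥ enc y ∥ (∈⇒∥∥≤ enc x∈))

∥left∥≤ : ∀ a b → ∥ a ∥ ≤ ∥ a ∙ b ∥
∥left∥≤ a b = m≤n⇒m≤1+n (m≤m+n ∥ a ∥ ∥ b ∥)

∥right∥≤ : ∀ a b → ∥ b ∥ ≤ ∥ a ∙ b ∥
∥right∥≤ a b = m≤n⇒m≤1+n (m≤n+m ∥ b ∥ ∥ a ∥)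

⌈log₂⌉≤ : ∀ n → ⌈log₂ n ⌉ ≤ n
⌈log₂⌉≤ n = subst (⌈log₂ n ⌉ ≤_) (⌈log₂2^n⌉≡n n) (⌈log₂⌉-mono-≤ (n≤2^n n))
  where
  n≤2^n : ∀ n → n ≤ 2 ^ n
  n≤2^n zero    = z≤n
  n≤2^n (suc n) = begin
    1 + n                ≤⟨ +-mono-≤ (m^n>0 2 n) (n≤2^n n) ⟩
    2 ^ n + 2 ^ n        ≤⟨ +-monoʳ-≤ (2 ^ n) (m≤m+n (2 ^ n) 0) ⟩
    2 ^ suc n            ∎

∥shortName∥ : ∀ G v → ∥ shortName G v ∥ ≤ suc (length (V G) * 2)
∥shortName∥ G v = begin
  ∥ shortName G v ∥                  ≡⟨ zeros ⌈log₂ length (V G) ⌉ ⟩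
  suc (⌈log₂ length (V G) ⌉ * 2)     ≤⟨ s≤s (*-monoˡ-≤ 2 (⌈log₂⌉≤ (length (V G)))) ⟩
  suc (length (V G) * 2)             ∎
  where
  zeros : ∀ n → ∥ encodeName (replicate n false) ∥ ≡ suc (n * 2)
  zeros zero    = refl
  zeros (suc n) = cong (2 +_) (zeros n)

length-cartesianProduct : {A B : Set} → ∀ (xs : List A) (ys : List B) →
                          length (cartesianProduct xs ys) ≡ length xs * length ys
length-cartesianProduct []       ys = refl
length-cartesianProduct (x ∷ xs) ys =
  trans (length-++ (map (x ,_) ys)) (cong₂ _+_ (length-map (x ,_) ys) (length-cartesianProduct xs ys))

length-E≤ : ∀ G → length (E G) ≤ length (V G) * length (V G)
length-E≤ G = begin
  length (E G)                             ≤⟨ Unique-⊆-length (AllPairs.map (λ { ¬same refl → ¬same (inj₁ (refl , refl)) }) (E-unique G))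
                                                (All.map (λ (u∈ , v∈ , _) → ∈-cartesianProduct⁺ u∈ v∈) (E-simple G)) ⟩
  length (cartesianProduct (V G) (V G))    ≡⟨ length-cartesianProduct (V G) (V G) ⟩
  length (V G) * length (V G)              ∎

-- Short names make the size depend on the number of vertices alone: a name is at most linear in it,
-- and the edges are at most its square.
graph-size : ∀ p → ∃[ p′ ] ∀ {G n} → length (V G) ≤⟦ p ⟧ n → ∣ G ∣ᴳ ≤⟦ p′ ⟧ n
graph-size p = _ , λ {G} v≤ →
  let name≤ = suc≤ (v≤ ⟨*⟩ con≤ 2) in
  suc≤ (≤-via (∥encodeList∥≤ (shortName G) (V G) (All.tabulate λ {v} _ → ∥shortName∥ G v))
          (suc≤ (v≤ ⟨*⟩ suc≤ name≤))
    ⟨+⟩ ≤-via (∥encodeList∥≤ (λ (u , v) → shortName G u ∙ shortName G v) (E G)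
            (All.tabulate λ { {u , v} _ → s≤s (+-mono-≤ (∥shortName∥ G u) (∥shortName∥ G v)) }))
          (suc≤ (≤-via (length-E≤ G) (v≤ ⟨*⟩ v≤) ⟨*⟩ suc≤ (suc≤ (name≤ ⟨+⟩ name≤)))))

list-size : ∀ p → ∃[ p′ ] ∀ {G n S} → length (V G) ≤⟦ p ⟧ n → length S ≤ n →
            ∥ encodeList (shortName G) S ∥ ≤⟦ p′ ⟧ n
list-size p = _ , λ {G} {_} {S} v≤ s≤ →
  ≤-via (∥encodeList∥≤ (shortName G) S (All.tabulate λ {v} _ → ∥shortName∥ G v))
    (suc≤ (var≤ s≤ ⟨*⟩ suc≤ (suc≤ (v≤ ⟨*⟩ con≤ 2))))

-- The kernelization

ends-length : ∀ S → length (ends S) ≡ suc (length S)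
ends-length S = trans (length-++ (map just S)) (trans (+-comm (length (map just S)) 1) (cong suc (length-map just S)))

slots-length : ∀ S → length (slots S) ≡ suc (length S) * suc (length S)
slots-length S = trans (length-cartesianProduct (ends S) (ends S)) (cong₂ _*_ (ends-length S) (ends-length S))

module Kernel {B} (G : BoundariedGraph B) (S : List Name) (cover : IsVertexCover (graph G) S) where

  open Auction (SlotAdj (graph G))

  I : List Name
  I = interior G S

  ks : List Slot
  ks = slots S

  unmatched : Entries
  unmatched = map initial ks

  occupants-initial : ∀ ks → occupants (map initial ks) ≡ []
  occupants-initial []       = refl
  occupants-initial (_ ∷ ks) = occupants-initial ks

  initial-stable : Stable ks I I unmatched []
  initial-stable = record
    { partition = ↭-reflexive (trans (cong (I ++_) (occupants-initial ks)) (++-identityʳ I))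
    ; keys      = trans (sym (map-∘ ks)) (map-id ks)
    ; settled   = Allₚ.map⁺ (All.tabulate λ _ ())
    ; vacant    = Allₚ.map⁺ (All.tabulate λ _ _ → refl)
    ; discarded = []
    }

  budget : ℕ
  budget = length I + potential ks I unmatched

  initial-potential : potential ks I unmatched ≡ length ks * suc (length ks)
  initial-potential = go ks
    where
    go : ∀ fs → sum (map (λ e → suc (length ks) ∸ label e) (map initial fs)) ≡ length fs * suc (length ks)
    go []       = refl
    go (_ ∷ fs) = cong (suc (length ks) +_) (go fs)

  result : ∃[ c ] ∃[ es ] ∃[ D ] Run c I 0 unmatched unmatched [] es D × Stable ks I [] es D ×
             c ≤ length unmatched + budget * suc (length ks)
  result = auction ks I (slotAdj? (graph G)) budget unmatched initial-stable
    (λ _ → Above-0 unmatched) (length-map initial ks) ≤-refl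

  D : List Name
  D = proj₁ (proj₂ (proj₂ result))

  es : Entries
  es = proj₁ (proj₂ result)

  stable : Stable ks I [] es D
  stable = proj₁ (proj₂ (proj₂ (proj₂ (proj₂ result))))

  open Stable stable using (partition; size)

  I! : Unique I
  I! = Uniqueₚ.filter⁺ _ (Uniqueₚ.filter⁺ _ (V-unique (graph G)))

  D⊆I : ∀ {v} → v ∈ D → v ∈ I
  D⊆I v∈D = ∈-resp-↭ partition (∈-++⁺ˡ v∈D)

  open Deletion G cover D⊆I using (G′; cover′; hasOffset) public

  offset : HasOffset LongPath G G′ (ℤ.+ 0)
  offset = hasOffset (stable-exchange ks I (×-≡-dec (Maybe-≡-dec _≟ᴺ_) (Maybe-≡-dec _≟ᴺ_)) I! stable)

  vertices⊆ : ∀ {v} → v ∈ V (graph G′) → v ∈ B ++ S ++ occupants es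
  vertices⊆ {v} v∈ with v∈V , v∉D ← ∈-without⁻ {xs = V (graph G)} v∈ with v ∈? S | v ∈? B
  ... | yes v∈S | _       = ∈-++⁺ʳ B (∈-++⁺ˡ v∈S)
  ... | no  _   | yes v∈B = ∈-++⁺ˡ v∈B
  ... | no  v∉S | no  v∉B with ∈-++⁻ D (∈-resp-↭ (↭-sym partition) (∈-without⁺ (∈-without⁺ v∈V v∉S) v∉B))
  ...   | inj₁ v∈D = contradiction v∈D v∉D
  ...   | inj₂ v∈O = ∈-++⁺ʳ B (∈-++⁺ʳ S v∈O)

  vertices≤ : length (V (graph G′)) ≤ (length B + length S) + suc (length S) * suc (length S)
  vertices≤ = begin
    length (V (graph G′))                                    ≤⟨ Unique-⊆-length (V-unique (graph G′)) (All.tabulate vertices⊆) ⟩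
    length (B ++ S ++ occupants es)                          ≡⟨ length-++ B ⟩
    length B + length (S ++ occupants es)                    ≡⟨ cong (length B +_) (length-++ S) ⟩
    length B + (length S + length (occupants es))            ≡⟨ +-assoc (length B) (length S) (length (occupants es)) ⟨
    (length B + length S) + length (occupants es)            ≤⟨ +-monoʳ-≤ (length B + length S) (occupants-length es) ⟩
    (length B + length S) + length es                        ≡⟨ cong (length B + length S +_) (trans size (slots-length S)) ⟩
    (length B + length S) + suc (length S) * suc (length S)  ∎

  -- Running time of the kernelization

  input : Data
  input = encodeInput VertexCover G S

  result-encoding : Data
  result-encoding = encodeBoundariedGraph encodeName G′ ∙ Names S ∙ encodeℤ (ℤ.+ 0)

  rounds : ℕ
  rounds = proj₁ result

  deleteCost edgesCost auctionCost interiorCost₁ interiorCost₂ endsCost tableCost : ℕ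
  interiorCost₁ = suc (length (V (graph G))) * (50 + 40 * ∥ Names S ∥)
  interiorCost₂ = suc (length (without (V (graph G)) S)) * (50 + 40 * ∥ Names B ∥)
  endsCost      = suc (length S) * (30 + 0)
  tableCost     = suc (length (ends S)) * (40 + suc (length (ends S)) * (40 + 0))
  auctionCost   = suc rounds * (200 + claimCost (graph G) (length ks) (length ks))
  deleteCost    = suc (length (V (graph G))) * (50 + 40 * ∥ Names D ∥)
  edgesCost     = suc (length (E (graph G))) * (90 + (40 * ∥ Names D ∥ + 40 * ∥ Names D ∥))

  -- The bracketing and the zeros are those that the evaluation rules produce, so `main↓` needs no
  -- rearrangement.
  mainCost : ℕ
  mainCost = 200 + (((interiorCost₁ + 0) + interiorCost₂) + (endsCost + (tableCost + (auctionCost + (((deleteCost + edgesCost) + 0) + 0)))))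

  main↓ : Calls mainᶠ input result-encoding mainCost
  main↓ = absorb 200 (mainCost ∸ 200) ≤-refl
    (let↓ (call↓ (cons↓ (call↓ basic↓ (without↓ (V (graph G)) S)) basic↓) (without↓ (without (V (graph G)) S) B))
    (let↓ (call↓ basic↓ (ends↓ S))
    (let↓ (call↓ basic↓ (table↓ (ends S) (ends S)))
    (let↓ (call↓ basic↓ (auction↓ (graph G) (proj₁ (proj₂ (proj₂ (proj₂ result)))) (length-map initial ks) (length-map initial ks)))
    (cons↓ (cons↓ (cons↓ (call↓ basic↓ (without↓ (V (graph G)) D)) (call↓ basic↓ (edges↓ (graph G) D))) basic↓) basic↓)))))

  V∖S-length : length (without (V (graph G)) S) ≤ length (V (graph G))
  V∖S-length = length-filter _ (V (graph G))

  I-length : length I ≤ length (V (graph G))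
  I-length = ≤-trans (length-filter _ (without (V (graph G)) S)) V∖S-length

  D⊆V : ∀ {v} → v ∈ D → v ∈ V (graph G)
  D⊆V = proj₁ ∘ Deletion.interior⁻ G cover D⊆I ∘ D⊆I

  rounds-bound : rounds ≤ length ks + (length I + length ks * suc (length ks)) * suc (length ks)
  rounds-bound = subst₂ (λ m Φ → rounds ≤ m + (length I + Φ) * suc (length ks))
    (length-map initial ks) initial-potential (proj₂ (proj₂ (proj₂ (proj₂ (proj₂ result)))))

  D-length : length D ≤ length (V (graph G))
  D-length = begin
    length D                                  ≤⟨ m≤m+n (length D) (length (occupants es)) ⟩
    length D + length (occupants es)          ≡⟨ length-++ D ⟨
    length (D ++ occupants es)                ≡⟨ ↭-length partition ⟩
    length I                                  ≤⟨ I-length ⟩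
    length (V (graph G))                      ∎

-- The polynomial itself is inferred from the proof, which mirrors the shape of mainCost.
mainCost-bound : ∃[ p ] ∀ {B} (G : BoundariedGraph B) S cover →
                 Kernel.mainCost G S cover ≤⟦ p ⟧ ∥ encodeInput VertexCover G S ∥
mainCost-bound = _ , λ {B} G S cover → let
    open Kernel G S cover
    N = ∥ input ∥
    graph≤  = ≤-trans (∥left∥≤ (encodeGraph encodeName (graph G)) (Names B)) (∥left∥≤ (encodeBoundariedGraph encodeName G) (Names S))
    ∥V∥≤N   = ≤-trans (∥left∥≤ (Names (V (graph G))) (Edges (E (graph G)))) graph≤
    ∥E∥≤N   = ≤-trans (∥right∥≤ (Names (V (graph G))) (Edges (E (graph G)))) graph≤
    ∥B∥≤N   = ≤-trans (∥right∥≤ (encodeGraph encodeName (graph G)) (Names B)) (∥left∥≤ (encodeBoundariedGraph encodeName G) (Names S))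
    ∥S∥≤N   = ∥right∥≤ (encodeBoundariedGraph encodeName G) (Names S)
    |V|≤N   = ≤-trans (length≤∥encodeList∥ encodeName (V (graph G))) ∥V∥≤N
    |S|≤N   = ≤-trans (length≤∥encodeList∥ encodeName S) ∥S∥≤N
    |E|≤N   = ≤-trans (length≤∥encodeList∥ encodeEdge (E (graph G))) ∥E∥≤N
    s       = suc≤ {N} (var≤ |S|≤N)
    v       = suc≤ {N} (var≤ |V|≤N)
    i       = var≤ {N} (≤-trans I-length |V|≤N)
    ends≤   = ≤-via {N} (≤-reflexive (ends-length S)) s
    k       = ≤-via {N} (≤-reflexive (slots-length S)) (s ⟨*⟩ s)
    -- Discarded names are names of the input, hence no larger than the input.
    d       = ≤-via {N} (∥encodeList∥≤ encodeName D (All.tabulate λ w∈D →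
                ≤-trans (∈⇒∥∥≤ encodeName (D⊆V w∈D)) ∥V∥≤N))
                (suc≤ (var≤ (≤-trans D-length |V|≤N) ⟨*⟩ suc≤ (var≤ ≤-refl)))
    member  = con≤ {N} 40 ⟨*⟩ var≤ ∥E∥≤N
    end     = con≤ {N} 40 ⟨+⟩ (member ⟨+⟩ member)
    unary   = ≤-via {N} (≤-reflexive (∥encodeUnary∥ (length ks))) (suc≤ (k ⟨*⟩ con≤ 2))
    claim   = suc≤ {N} k ⟨*⟩ (con≤ 200 ⟨+⟩ (con≤ 30 ⟨*⟩ unary ⟨+⟩ (end ⟨+⟩ end)))
    rounds≤ = ≤-via {N} rounds-bound (k ⟨+⟩ (i ⟨+⟩ k ⟨*⟩ suc≤ k) ⟨*⟩ suc≤ k)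
    drop    = con≤ {N} 40 ⟨*⟩ d
    row     = suc≤ {N} ends≤ ⟨*⟩ (con≤ 40 ⟨+⟩ con≤ 0)
    dropS   = con≤ {N} 50 ⟨+⟩ con≤ 40 ⟨*⟩ var≤ ∥S∥≤N
    dropB   = con≤ {N} 50 ⟨+⟩ con≤ 40 ⟨*⟩ var≤ ∥B∥≤N
    V∖S     = suc≤ {N} (var≤ (≤-trans V∖S-length |V|≤N))
    inner   = (v ⟨*⟩ dropS ⟨+⟩ con≤ 0) ⟨+⟩ V∖S ⟨*⟩ dropB
    table   = suc≤ {N} ends≤ ⟨*⟩ (con≤ 40 ⟨+⟩ row)
    auction = suc≤ {N} rounds≤ ⟨*⟩ (con≤ 200 ⟨+⟩ claim)
    edges   = suc≤ {N} (var≤ |E|≤N) ⟨*⟩ (con≤ 90 ⟨+⟩ (drop ⟨+⟩ drop))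
    delete  = v ⟨*⟩ (con≤ {N} 50 ⟨+⟩ drop) ⟨+⟩ edges ⟨+⟩ con≤ 0 ⟨+⟩ con≤ 0
    total   = con≤ {N} 200 ⟨+⟩ (inner ⟨+⟩ (s ⟨*⟩ (con≤ 30 ⟨+⟩ con≤ 0) ⟨+⟩ (table ⟨+⟩ (auction ⟨+⟩ delete))))
  in total

-- Size bounds and the quadratic vertex bound

kernelProgram : Program
kernelProgram = record { functions = F }

vertexBound : Poly
vertexBound = X :+ (con 1 :+ X) :* (con 1 :+ X)

sizeBound : Poly
sizeBound = proj₁ (graph-size vertexBound) :+ (proj₁ (list-size vertexBound) :+ X)

module _ {B} (G : BoundariedGraph B) (S : List Name) (cover : IsVertexCover (graph G) S) where

  open Kernel G S cover

  private
    p : ℕ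
    p = length B + length S

    |S|≤p : length S ≤ p
    |S|≤p = m≤n+m (length S) (length B)

    vertices-bound : length (V (graph G′)) ≤⟦ vertexBound ⟧ p
    vertices-bound = ≤-via vertices≤ (var≤ ≤-refl ⟨+⟩ suc≤ (var≤ |S|≤p) ⟨*⟩ suc≤ (var≤ |S|≤p))

    graph-bound  = bound (proj₂ (graph-size vertexBound) {graph G′} vertices-bound)
    cover-bound  = bound (proj₂ (list-size vertexBound) {graph G′} {S = S} vertices-bound |S|≤p)

  kernelOutput : KernelOutput LongPath VertexCover ⟦ sizeBound ⟧ G S
  kernelOutput = record
    { G′         = G′
    ; s′         = S
    ; s′-sol     = cover′
    ; equivalent = ℤ.+ 0 , offset
    ; G′-size    = ≤-trans graph-bound (m≤m+n g (l + p))
    ; s′-size    = ≤-trans cover-bound (≤-trans (m≤m+n l p) (m≤n+m (l + p) g))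
    ; s′-value   = ≤-trans |S|≤p (≤-trans (m≤n+m p l) (m≤n+m (l + p) g))
    }
    where
    g = ⟦ proj₁ (graph-size vertexBound) ⟧ p
    l = ⟦ proj₁ (list-size vertexBound) ⟧ p

  kernel-computed : Computes kernelProgram ⟨ encodeInput VertexCover G S ⟩ KernelOutput.encoded kernelOutput
                      within ⟦ proj₁ mainCost-bound ⟧ ∥ encodeInput VertexCover G S ∥
  kernel-computed = Evaluates.time main↓ , Evaluates.derivation main↓ ,
    ≤-trans (Evaluates.bound main↓) (bound (proj₂ mainCost-bound G S cover))

  -- The constant and the threshold come from `p + (1 + p) * (1 + p)`, which equals `5 * p ^ 2` at
  -- `p = 1` and stays below it afterwards; for `p = suc m` the slack is `4 * (m * m) + 5 * m`.
  outputVertices : 1 ≤ p → length (V (graph G′)) ≤ 5 * p ^ 2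
  outputVertices 1≤p = ≤-trans (bound vertices-bound) (quadratic p 1≤p)
    where
    identity : ∀ m → suc m + suc (suc m) * suc (suc m) + (4 * (m * m) + 5 * m) ≡ 5 * (suc m * (suc m * 1))
    identity = solve-∀
    quadratic : ∀ n → 1 ≤ n → ⟦ vertexBound ⟧ n ≤ 5 * n ^ 2
    quadratic (suc m) _ = m+n≤o⇒m≤o (⟦ vertexBound ⟧ (suc m)) (≤-reflexive (identity m))

mainTheorem7 : Σ[ K ∈ PolynomialBoundariedKernelization LongPath VertexCover ]
    HasOutputVertices-O K (λ n → n ^ 2)
mainTheorem7 =
  record
    { size          = ⟦ sizeBound ⟧
    ; polysize      = polynomial sizeBound
    ; kernelization = record
      { program  = kernelProgram
      ; time     = ⟦ proj₁ mainCost-bound ⟧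
      ; polytime = polynomial (proj₁ mainCost-bound)
      ; output   = kernelOutput
      ; computed = kernel-computed
      }
    } ,
  5 , 1 , outputVertices
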